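{- Let $n\geq 4$ and $\ell$ be integers with $2\leq \ell\leq n-1$. (1) For $\ell=n-1$, $e_3(n,n-1,3)=n-1$. (2) For $\ell=n-2$, $e_3(n,n-2,3)=2n-5$. (3) For $\ell=n-3$, $e_3(n,n-3,3)=2n-5$. (4) For $\ell=2$: $e_3(n,2,3)=3$ if $n=4$; $e_3(n,2,3)=5$ if $n=5$; $e_3(n,2,3)=\infty$ if $n\geq 6$. (5) For $\frac{n}{2}\leq \ell\leq n-4$, $n\leq e_3(n,\ell,3)\leq \ell(n-\ell)$.
   Context: All graphs are undirected, finite and simple. For a graph $G$ and a nonempty set $S\subseteq V(G)$, the Steiner distance $d_G(S)$ is the minimum number of edges of a connected subgraph (equivalently, a subtree) of $G$ whose vertex set contains $S$; set $d_G(S)=\infty$ if there is none. The Steiner $3$-diameter is $sdiam_3(G)=\max\{d_G(S): S\subseteq V(G),\ |S|=3\}$. For natural numbers $n,\ell,d$ with $d<n$, $\ell<n$, let $\mathscr{H}_3(n,\ell,d)$ be the set of all graphs $G$ of order $n$ with maximum degree exactly $\ell$ and $sdiam_3(G)\leq d$. Put $e_3(n,\ell,d)=\min\{|E(G)|: G\in \mathscr{H}_3(n,\ell,d)\}$, with $e_3(n,\ell,d)=\infty$ if $\mathscr{H}_3(n,\ell,d)=\emptyset$. -}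

module Defs where

open import Data.Bool.Base using (Bool; true; false; _∧_)
open import Data.Fin.Base using (Fin; toℕ)
open import Data.Fin.Subset using (Subset; _∈_; _⊆_; ∣_∣)
open import Data.Nat.Base using (ℕ; _≤_; _<ᵇ_)
open import Data.Nat.Properties using (+-0-commutativeMonoid)
open import Data.Product.Base using (Σ-syntax; ∃-syntax; _×_)
open import Data.Vec.Base using (tabulate)
open import Relation.Binary.Construct.Closure.ReflexiveTransitive using (Star)
open import Relation.Binary.PropositionalEquality.Core using (_≡_)
open import Relation.Nullary.Negation.Core using (¬_)
open import Relation.Nullary.Construct.Add.Supremum using (_⁺; [_]; ⊤⁺)
open import Algebra.Properties.CommutativeMonoid.Sum +-0-commutativeMonoid using (sum)
open import Relation.Binary.Construct.Add.Supremum.NonStrict _≤_ using (_≤⁺_) public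

-- ℕ ∪ {∞}, with ∞ written ⊤⁺ and a finite value k written [ k ].
ℕ∞ : Set
ℕ∞ = ℕ ⁺

-- v = min P, where the minimum of the empty set is ∞.
IsMin : (ℕ → Set) → ℕ∞ → Set
IsMin P [ k ] = P k × (∀ j → P j → k ≤ j)
IsMin P ⊤⁺    = ∀ j → ¬ P j

IsMax : (ℕ∞ → Set) → ℕ∞ → Set
IsMax P v = P v × (∀ w → P w → w ≤⁺ v)

-- Finite simple graphs of order n, up to naming the vertices by Fin n.
record Graph (n : ℕ) : Set where
  field
    adj    : Fin n → Fin n → Bool
    sym    : ∀ u v → adj u v ≡ adj v u
    irrefl : ∀ v → adj v v ≡ false

open Graph public using (adj)

Adj : ∀ {n} → Graph n → Fin n → Fin n → Set
Adj G u v = adj G u v ≡ true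

degree : ∀ {n} → Graph n → Fin n → ℕ
degree G v = ∣ tabulate (adj G v) ∣

-- ∣E(G)∣: the edge {u , v} is counted once, at its smaller endpoint.
size : ∀ {n} → Graph n → ℕ
size G = sum λ u → ∣ tabulate (λ v → (toℕ u <ᵇ toℕ v) ∧ adj G u v) ∣

MaxDegree : ∀ {n} → Graph n → ℕ → Set
MaxDegree G ℓ = (∃[ v ] degree G v ≡ ℓ) × (∀ v → degree G v ≤ ℓ)

-- The edges of a subgraph are kept as a graph on all of Fin n, in which the
-- vertices outside the subgraph are isolated.
record Subgraph {n} (G : Graph n) : Set where
  field
    vertices : Subset n
    edges    : Graph n
    sub      : ∀ {u v} → Adj edges u v → Adj G u v
    ends     : ∀ {u v} → Adj edges u v → u ∈ vertices

open Subgraph public using (vertices; edges)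

-- By `ends`, a walk starting at a vertex of the subgraph stays inside it.
Connected : ∀ {n} {G : Graph n} → Subgraph G → Set
Connected H = ∀ {u v} → u ∈ vertices H → v ∈ vertices H → Star (Adj (edges H)) u v

-- v = d_G(S)
IsSteinerDistance : ∀ {n} → Graph n → Subset n → ℕ∞ → Set
IsSteinerDistance G S = IsMin λ k →
  Σ[ H ∈ Subgraph G ] Connected H × S ⊆ vertices H × size (edges H) ≡ k

-- v = sdiam₃(G)
IsSteiner3Diameter : ∀ {n} → Graph n → ℕ∞ → Set
IsSteiner3Diameter {n} G = IsMax λ w →
  Σ[ S ∈ Subset n ] ∣ S ∣ ≡ 3 × IsSteinerDistance G S w

-- G ∈ ℋ₃(n,ℓ,d)
record ℋ₃ (n ℓ d : ℕ) (G : Graph n) : Set where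
  field
    maxDegree : MaxDegree G ℓ
    sdiam≤d   : ∃[ w ] IsSteiner3Diameter G w × w ≤⁺ [ d ]

-- v = e₃(n,ℓ,d)
e₃[_,_,_]≔_ : ℕ → ℕ → ℕ → ℕ∞ → Set
e₃[ n , ℓ , d ]≔ v = IsMin (λ k → Σ[ G ∈ Graph n ] ℋ₃ n ℓ d G × size G ≡ k) v

infix 4 e₃[_,_,_]≔_

{-# OPTIONS --safe #-}
module Submission where

-- Since sdiam₃ ≤ 3, a vertex a and two of its non-neighbours b, c always have a
-- common tree of the form a ─ u plus two of the three edges ub, uc, bc.  In
-- particular all but at most one non-neighbour of a are at distance two.  For a
-- lower bound on the size, rank the vertices around a vertex v of maximum
-- degree and count, at each vertex, its neighbours of smaller rank; the above
-- property supplies these neighbours.  The upper bounds come from a star, from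
-- two graphs close to K_{2,m}, and from the complete bipartite graph.
-- That the minimum in (5) exists constructively rests on deciding membership in
-- ℋ₃, which is done by growing a tree vertex by vertex.

open import Defs
open import Data.Bool.Base using (Bool; true; false; _∧_; _∨_; not; if_then_else_)
import Data.Bool.Properties as Bool
open import Data.Bool.Properties using (T-≡; not-injective; ∧-zeroʳ; ∨-idem; ∧-comm; ∨-comm)
open import Data.Empty using (⊥; ⊥-elim)
open import Data.Fin.Base using (Fin; zero; suc; toℕ; combine; remQuot)
open import Data.Fin.Patterns using (0F; 1F; 2F; 3F; 4F)
open import Data.Fin.Properties using (_≟_; any?; all?; toℕ-injective; remQuot-combine)
open import Data.Fin.Subset using (Subset; ∣_∣; _∈_; _∉_; _⊆_; _∪_; ⁅_⁆)
open import Data.Fin.Subset.Properties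
  using (_∈?_; _⊆?_; anySubset?; nonempty?; Empty-unique; ∣⊥∣≡0; x∈⁅x⁆; x∈⁅y⁆⇒x≡y; p⊆p∪q; q⊆p∪q;
         x∈p∪q⁻; x∈p∪q⁺)
open import Data.List.Base using (List; []; _∷_; length)
open import Data.List.Relation.Unary.All as All using (All; []; _∷_)
open import Data.List.Relation.Unary.AllPairs using ([]; _∷_)
open import Data.List.Relation.Unary.Unique.Propositional using (Unique)
open import Data.Nat.Base using (ℕ; zero; suc; _≤_; _<_; _*_; _∸_; _+_; _<ᵇ_; z≤n; s≤s; s≤s⁻¹; z<s)
open import Data.Nat.Properties
  using (+-0-commutativeMonoid; +-*-semiring; +-assoc; +-comm; +-suc; +-identityʳ; *-identityʳ;
         *-zeroʳ; +-mono-≤; +-monoʳ-≤; +-monoˡ-≤; +-monoʳ-<; +-cancelʳ-≤; +-cancelˡ-<;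
         m+n≡0⇒m≡0; m+n≡0⇒n≡0; m+n∸m≡n; m≤n+o⇒m∸n≤o; m<n⇒0<n∸m; m≤m+n; m≤n+m; m≤n⇒m≤1+n; n≤1+n;
         n≮n; ≤-refl; ≤-reflexive; ≤-trans; ≤-antisym; ≰⇒>; <⇒≤; <-asym; <-cmp; <⇒<ᵇ; <ᵇ⇒<;
         _≤?_; module ≤-Reasoning)
  renaming (_≟_ to _≟ℕ_)
open import Data.Nat.Tactic.RingSolver using (solve-∀)
open import Data.Product.Base using (uncurry; _×_; Σ-syntax; ∃-syntax; _,_; proj₁; proj₂)
open import Data.Sum.Base as Sum using (_⊎_; inj₁; inj₂; [_,_]′; swap)
open import Data.Vec.Base using (tabulate; lookup)
open import Data.Vec.Properties
  using ([]=⇒lookup; lookup⇒[]=; lookup∘tabulate; tabulate∘lookup; tabulate-cong)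
open import Function.Base using (_∘_)
open import Function.Bundles using (Equivalence)
open import Relation.Binary.Construct.Closure.ReflexiveTransitive as Star using (Star; ε; _◅_; _◅◅_)
open import Relation.Binary.Definitions using (tri<; tri≈; tri>)
open import Relation.Binary.PropositionalEquality
  using (_≡_; _≢_; refl; sym; trans; cong; cong₂; subst; ≢-sym)
open import Relation.Nullary using (Dec; does; yes; no; ¬_; ¬?; _×-dec_; _⊎-dec_)
open import Relation.Nullary.Construct.Add.Supremum using ([_]; ⊤⁺)
open import Relation.Nullary.Decidable
  using (decidable-stable; ¬¬-excluded-middle; map′; dec-true; dec-false)
open import Relation.Nullary.Negation using (contradiction)
open import Algebra.Properties.CommutativeMonoid.Sum +-0-commutativeMonoid
  using (sum; ∑-distrib-+; ∑-comm; sum-cong-≗; sum-replicate-zero)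
open import Algebra.Properties.Semiring.Sum +-*-semiring using (*-distribʳ-sum)
open import Relation.Binary.Construct.Add.Supremum.NonStrict _≤_
  using ([_]; ≤⁺-trans; [≤]-injective)

-- The constants record where the count can lose an edge. For ℓ = n - 2, every neighbour of `v` has
-- a second earlier neighbour, leading towards the non-neighbour `w`, with one possible exception:
-- 2ℓ - 1 = 2n - 5. For ℓ = n - 3 there are two non-neighbours. If they are adjacent, they act as a
-- joint target, no exception occurs, and the edge between them gives 2ℓ + 1 = 2n - 5. If not, the
-- exception returns and must be repaid by two edges at the second non-neighbour; here the
-- maximality of the degree is used. In (5), an earlier neighbour for each vertex but the root gives
-- n - 1 edges, and the work lies in finding a vertex with two of them, which excludes trees. A
-- second obstacle is logical: a Steiner distance is a minimum over an undecided predicate and may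
-- be ∞, while membership in ℋ₃ asserts that a maximum of such distances exists. Both directions
-- pass through the decidable `Spans`: members are built by minimising over it, and from a given
-- member only this stable statement is extracted.

private
  variable
    n k : ℕ

-- Counting edges

𝟙 : Bool → ℕ
𝟙 true  = 1
𝟙 false = 0

𝟙-split : ∀ {a b c} → (a ≡ true → b ≡ true ⊎ c ≡ true) → 𝟙 a ≤ 𝟙 b + 𝟙 c
𝟙-split {false} _ = z≤n
𝟙-split {true} {b} h with h refl
... | inj₁ refl = s≤s z≤n
... | inj₂ refl = m≤n+m 1 (𝟙 b)

𝟙-join : ∀ {a b c} → (a ≡ true → c ≡ true) → (b ≡ true → c ≡ true) →
         (a ≡ true → b ≡ true → ⊥) → 𝟙 a + 𝟙 b ≤ 𝟙 c
𝟙-join {true}  {true}  _ _ h = ⊥-elim (h refl refl)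
𝟙-join {true}  {false} f _ _ rewrite f refl = s≤s z≤n
𝟙-join {false} {true}  _ f _ rewrite f refl = s≤s z≤n
𝟙-join {false} {false} _ _ _ = z≤n

𝟙-mono : ∀ {a b} → (a ≡ true → b ≡ true) → 𝟙 a ≤ 𝟙 b
𝟙-mono {false} _ = z≤n
𝟙-mono {true}  h rewrite h refl = s≤s z≤n

∧-true⁻ : ∀ {a b} → a ∧ b ≡ true → a ≡ true × b ≡ true
∧-true⁻ {true} {true} _ = refl , refl

∧-true⁺ : ∀ {a b} → a ≡ true → b ≡ true → a ∧ b ≡ true
∧-true⁺ refl refl = refl

∨-true⁻ : ∀ {a b} → a ∨ b ≡ true → a ≡ true ⊎ b ≡ true
∨-true⁻ {true}  _ = inj₁ refl
∨-true⁻ {false} h = inj₂ h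

∨-true⁺ʳ : ∀ {a b} → b ≡ true → a ∨ b ≡ true
∨-true⁺ʳ {true}  _ = refl
∨-true⁺ʳ {false} h = h

∨-true⁺ˡ : ∀ {a b} → a ≡ true → a ∨ b ≡ true
∨-true⁺ˡ refl = refl

false≢true : ∀ {b} → b ≡ false → b ≡ true → ⊥
false≢true refl ()

<⇒<ᵇ-true : ∀ {m k} → m < k → (m <ᵇ k) ≡ true
<⇒<ᵇ-true p = Equivalence.to T-≡ (<⇒<ᵇ p)

<ᵇ-true⇒< : ∀ {m k} → (m <ᵇ k) ≡ true → m < k
<ᵇ-true⇒< {m} {k} p = <ᵇ⇒< m k (Equivalence.from T-≡ p)

_==_ : Fin n → Fin n → Bool
x == y = does (x ≟ y)

==-refl : (x : Fin n) → (x == x) ≡ true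
==-refl x = dec-true (x ≟ x) refl

==-sound : {x y : Fin n} → (x == y) ≡ true → x ≡ y
==-sound {x = x} {y} p with yes q ← x ≟ y = q

≢⇒== : {x y : Fin n} → x ≢ y → (x == y) ≡ false
≢⇒== {x = x} {y} = dec-false (x ≟ y)

δ : Fin n → Fin n → ℕ
δ x y = 𝟙 (x == y)

δ-refl : (x : Fin n) → δ x x ≡ 1
δ-refl x = cong 𝟙 (==-refl x)

δ-≢ : {x y : Fin n} → x ≢ y → δ x y ≡ 0
δ-≢ x≢y = cong 𝟙 (≢⇒== x≢y)

sum-mono : {f g : Fin n → ℕ} → (∀ x → f x ≤ g x) → sum f ≤ sum g
sum-mono {zero}  _ = z≤n
sum-mono {suc n} h = +-mono-≤ (h zero) (sum-mono (h ∘ suc))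

sum-const : ∀ n k → sum {n} (λ _ → k) ≡ n * k
sum-const zero    k = refl
sum-const (suc n) k = cong (k +_) (sum-const n k)

sum-δ : (x : Fin n) → sum (δ x) ≡ 1
sum-δ {suc n} zero    = cong suc (sum-replicate-zero n)
sum-δ {suc n} (suc x) = sum-δ x

# : (Fin n → Bool) → ℕ
# p = sum (𝟙 ∘ p)

∣tabulate∣ : (p : Fin n → Bool) → ∣ tabulate p ∣ ≡ # p
∣tabulate∣ {zero}  p = refl
∣tabulate∣ {suc n} p with p zero
... | true  = cong suc (∣tabulate∣ (p ∘ suc))
... | false = ∣tabulate∣ (p ∘ suc)

degree≡# : (G : Graph n) (v : Fin n) → degree G v ≡ # (adj G v)
degree≡# G v = ∣tabulate∣ (adj G v)

length≤# : ∀ {p : Fin n → Bool} {xs} → Unique xs → All (λ x → p x ≡ true) xs → length xs ≤ # p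
length≤# [] [] = z≤n
length≤# {p = p} {x ∷ xs} (x∉xs ∷ xs!) (px ∷ pxs) = begin
  suc (length xs)      ≤⟨ s≤s (length≤# xs! (All.zipWith others (x∉xs , pxs))) ⟩
  1 + # p∖x            ≡⟨ cong (_+ # p∖x) (sum-δ x) ⟨
  sum (δ x) + # p∖x    ≡⟨ ∑-distrib-+ (δ x) _ ⟨
  sum (λ y → δ x y + 𝟙 (p∖x y))
    ≤⟨ sum-mono (λ y → 𝟙-join (λ e → subst (λ z → p z ≡ true) (==-sound e) px)
      (λ e → proj₁ (∧-true⁻ {p y} e)) (disj y)) ⟩
  # p                  ∎
  where
  open ≤-Reasoning
  p∖x = λ y → p y ∧ not (x == y)
  others : ∀ {y} → x ≢ y × p y ≡ true → p∖x y ≡ true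
  others (x≢y , py) = ∧-true⁺ py (cong not (≢⇒== x≢y))
  disj : ∀ y → (x == y) ≡ true → p∖x y ≡ true → ⊥
  disj y e q with ∧-true⁻ {p y} q
  ... | _ , r rewrite e with () ← r

#-complement : (p : Fin n → Bool) → # p + # (not ∘ p) ≡ n
#-complement {zero}  p = refl
#-complement {suc n} p with p zero
... | true  = cong suc (#-complement (p ∘ suc))
... | false = trans (+-suc _ _) (cong suc (#-complement (p ∘ suc)))

∃-zero : (f : Fin n → ℕ) → sum f < n → ∃[ x ] f x ≡ 0
∃-zero {suc n} f h with f zero in eq
... | zero = zero , eq
... | suc k with ∃-zero (f ∘ suc) (≤-trans (s≤s (m≤n+m _ k)) (s≤s⁻¹ h))
... | x , e = suc x , e

multiplicity : List (Fin n) → Fin n → ℕ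
multiplicity []       y = 0
multiplicity (x ∷ xs) y = δ x y + multiplicity xs y

sum-multiplicity : (xs : List (Fin n)) → sum (multiplicity xs) ≡ length xs
sum-multiplicity {n} []       = sum-replicate-zero n
sum-multiplicity (x ∷ xs) =
  trans (∑-distrib-+ (δ x) _) (cong₂ _+_ (sum-δ x) (sum-multiplicity xs))

multiplicity≡0 : ∀ (xs : List (Fin n)) {y} → multiplicity xs y ≡ 0 → All (_≢ y) xs
multiplicity≡0 []       _ = []
multiplicity≡0 (x ∷ xs) {y} e =
  (λ { refl → contradiction (trans (sym (δ-refl x)) (m+n≡0⇒m≡0 _ e)) λ () })
  ∷ multiplicity≡0 xs (m+n≡0⇒n≡0 (δ x y) e)

-- Pigeonhole: the failures of `p` and the entries of `xs` have total weight below `n`, so some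
-- vertex has weight zero.
#⇒∃-outside : ∀ (p : Fin n → Bool) xs → length xs < # p → ∃[ x ] p x ≡ true × All (_≢ x) xs
#⇒∃-outside {n} p xs l with ∃-zero (λ x → 𝟙 (not (p x)) + multiplicity xs x) few
  where
  open ≤-Reasoning
  few = begin-strict
    sum (λ x → 𝟙 (not (p x)) + multiplicity xs x)  ≡⟨ ∑-distrib-+ (𝟙 ∘ not ∘ p) _ ⟩
    # (not ∘ p) + sum (multiplicity xs)            ≡⟨ cong (# (not ∘ p) +_) (sum-multiplicity xs) ⟩
    # (not ∘ p) + length xs                        <⟨ +-monoʳ-< (# (not ∘ p)) l ⟩
    # (not ∘ p) + # p                              ≡⟨ +-comm _ (# p) ⟩
    # p + # (not ∘ p)                              ≡⟨ #-complement p ⟩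
    n                                              ∎
... | x , e with p x in px
...   | true = x , px , multiplicity≡0 xs e

module _ (G : Graph n) where

  adj-sym : ∀ {u v b} → adj G u v ≡ b → adj G v u ≡ b
  adj-sym {u} {v} e = trans (Graph.sym G v u) e

  Adj⇒≢ : ∀ {u v} → Adj G u v → u ≢ v
  Adj⇒≢ {u} e refl = false≢true (Graph.irrefl G u) e

  length≤degree : ∀ {v xs} → Unique xs → All (Adj G v) xs → length xs ≤ degree G v
  length≤degree {v} xs! a rewrite degree≡# G v = length≤# xs! a

  degree+nonneighbours≤n : ∀ {v xs} → Unique xs → All (λ x → adj G v x ≡ false) xs →
                           degree G v + length xs ≤ n
  degree+nonneighbours≤n {v} {xs} xs! a = begin
    degree G v + length xs
      ≤⟨ +-mono-≤ (≤-reflexive (degree≡# G v)) (length≤# xs! (All.map (cong not) a)) ⟩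
    # (adj G v) + # (not ∘ adj G v)      ≡⟨ #-complement (adj G v) ⟩
    n                                    ∎
    where
    open ≤-Reasoning

  ∃-nonneighbour : ∀ v xs → degree G v + length xs < n →
                   ∃[ w ] adj G v w ≡ false × All (_≢ w) xs
  ∃-nonneighbour v xs h = let w , e , outside = #⇒∃-outside (not ∘ adj G v) xs few in
    w , not-injective e , outside
    where
    open ≤-Reasoning
    few = +-cancelˡ-< (# (adj G v)) _ _ (begin-strict
      # (adj G v) + length xs            ≡⟨ cong (_+ length xs) (degree≡# G v) ⟨
      degree G v + length xs             <⟨ h ⟩
      n                                  ≡⟨ #-complement (adj G v) ⟨
      # (adj G v) + # (not ∘ adj G v)    ∎)

  ∃-neighbour : ∀ v xs → length xs < degree G v →
                ∃[ w ] Adj G v w × All (_≢ w) xs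
  ∃-neighbour v xs h = #⇒∃-outside (adj G v) xs (≤-trans h (≤-reflexive (degree≡# G v)))

##  : (Fin n → Fin n → Bool) → ℕ
## r = sum (λ u → # (r u))

_<ᶠ_ : Fin n → Fin n → Bool
u <ᶠ v = toℕ u <ᵇ toℕ v

size≡## : (G : Graph n) → size G ≡ ## (λ u v → (u <ᶠ v) ∧ adj G u v)
size≡## G = sum-cong-≗ (λ u → ∣tabulate∣ (λ v → (u <ᶠ v) ∧ adj G u v))

##-mono+ : (p q r : Fin n → Fin n → Bool) → (∀ u v → 𝟙 (p u v) ≤ 𝟙 (q u v) + 𝟙 (r u v)) → ## p ≤ ## q + ## r
##-mono+ p q r h = begin
  ## p                                        ≤⟨ sum-mono (λ u → sum-mono (h u)) ⟩
  sum (λ u → sum λ v → 𝟙 (q u v) + 𝟙 (r u v)) ≡⟨ sum-cong-≗ (λ u → ∑-distrib-+ (𝟙 ∘ q u) (𝟙 ∘ r u)) ⟩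
  sum (λ u → # (q u) + # (r u))               ≡⟨ ∑-distrib-+ (# ∘ q) (# ∘ r) ⟩
  ## q + ## r                                 ∎
  where open ≤-Reasoning

##-+mono : (p q r : Fin n → Fin n → Bool) → (∀ u v → 𝟙 (p u v) + 𝟙 (q u v) ≤ 𝟙 (r u v)) → ## p + ## q ≤ ## r
##-+mono p q r h = begin
  ## p + ## q                                 ≡⟨ ∑-distrib-+ (# ∘ p) (# ∘ q) ⟨
  sum (λ u → # (p u) + # (q u))               ≡⟨ sum-cong-≗ (λ u → ∑-distrib-+ (𝟙 ∘ p u) (𝟙 ∘ q u)) ⟨
  sum (λ u → sum λ v → 𝟙 (p u v) + 𝟙 (q u v)) ≤⟨ sum-mono (λ u → sum-mono (h u)) ⟩
  ## r                                        ∎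
  where open ≤-Reasoning

##-flip : (r : Fin n → Fin n → Bool) → ## r ≡ ## (λ u v → r v u)
##-flip r = ∑-comm (λ u v → 𝟙 (r u v))

module _ (G : Graph n) {r : Fin n → Fin n → Bool} where
  private
    up down : Fin n → Fin n → Bool
    up   u v = (u <ᶠ v) ∧ r u v
    down u v = (v <ᶠ u) ∧ r u v

  -- Arcs of `r` may run against the numbering of the vertices, while `size` counts an edge at its
  -- smaller end. The backward arcs are therefore transposed; by antisymmetry they never land on a
  -- forward arc.
  orientation≤size : (∀ {u v} → r u v ≡ true → Adj G u v) →
                     (∀ {u v} → r u v ≡ true → r v u ≡ true → ⊥) → ## r ≤ size G
  orientation≤size r⊆G antisym = begin
    ## r                                    ≤⟨ ##-mono+ r up down (λ u v → 𝟙-split (compare u v)) ⟩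
    ## up + ## down                         ≡⟨ cong (## up +_) (##-flip down) ⟩
    ## up + ## (λ u v → (u <ᶠ v) ∧ r v u)
      ≤⟨ ##-+mono up (λ u v → (u <ᶠ v) ∧ r v u) (λ u v → (u <ᶠ v) ∧ adj G u v)
        (λ u v → 𝟙-join {(u <ᶠ v) ∧ r u v}
                                                 (λ e → let p , q = ∧-true⁻ {u <ᶠ v} e in ∧-true⁺ p (r⊆G q))
                                                 (λ e → let p , q = ∧-true⁻ {u <ᶠ v} e in ∧-true⁺ p (adj-sym G (r⊆G q)))
                                                 (λ e e′ → antisym (proj₂ (∧-true⁻ {u <ᶠ v} e))
                                                     (proj₂ (∧-true⁻ {u <ᶠ v} e′)))) ⟩
    ## (λ u v → (u <ᶠ v) ∧ adj G u v)       ≡⟨ size≡## G ⟨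
    size G                                  ∎
    where
    open ≤-Reasoning
    compare : ∀ u v → r u v ≡ true → up u v ≡ true ⊎ down u v ≡ true
    compare u v e with <-cmp (toℕ u) (toℕ v)
    ... | tri< p _ _ = inj₁ (∧-true⁺ (<⇒<ᵇ-true p) e)
    ... | tri≈ _ p _ = ⊥-elim (Adj⇒≢ G (r⊆G e) (toℕ-injective p))
    ... | tri> _ _ p = inj₂ (∧-true⁺ (<⇒<ᵇ-true p) e)

  size≤orientation : (∀ {u v} → Adj G u v → r u v ≡ true ⊎ r v u ≡ true) → size G ≤ ## r
  size≤orientation G⊆r = begin
    size G                                  ≡⟨ size≡## G ⟩
    ## (λ u v → (u <ᶠ v) ∧ adj G u v)
      ≤⟨ ##-mono+ (λ u v → (u <ᶠ v) ∧ adj G u v) up (λ u v → (u <ᶠ v) ∧ r v u) (λ u v → 𝟙-split (split u v)) ⟩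
    ## up + ## (λ u v → (u <ᶠ v) ∧ r v u)   ≡⟨ cong (## up +_) (##-flip down) ⟨
    ## up + ## down                         ≤⟨ ##-+mono up down r (λ u v → 𝟙-join {(u <ᶠ v) ∧ r u v}
                                                 (proj₂ ∘ ∧-true⁻ {u <ᶠ v}) (proj₂ ∘ ∧-true⁻ {v <ᶠ u})
                                                 (λ e e′ → <-asym {toℕ u} {toℕ v}
                                                     (<ᵇ-true⇒< (proj₁ (∧-true⁻ {u <ᶠ v} e)))
                                                         (<ᵇ-true⇒< (proj₁ (∧-true⁻ {v <ᶠ u} e′))))) ⟩
    ## r                                    ∎
    where
    open ≤-Reasoning
    split : ∀ u v → (u <ᶠ v) ∧ adj G u v ≡ true → up u v ≡ true ⊎ (u <ᶠ v) ∧ r v u ≡ true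
    split u v e with p , q ← ∧-true⁻ {u <ᶠ v} e with G⊆r q
    ... | inj₁ s = inj₁ (∧-true⁺ p s)
    ... | inj₂ s = inj₂ (∧-true⁺ p s)

arc : Fin n → Fin n → Fin n → Fin n → Bool
arc p q u v = (p == u) ∧ (q == v)

##-arc : ∀ {n} (p q : Fin n) → ## (arc p q) ≡ 1
##-arc {n} p q = trans (sum-cong-≗ row) (sum-δ p)
  where
  row : ∀ u → # (arc p q u) ≡ δ p u
  row u with p == u
  ... | true  = sum-δ q
  ... | false = sum-replicate-zero n
  
arc⁻ : {p q u v : Fin n} → arc p q u v ≡ true → p ≡ u × q ≡ v
arc⁻ e = let e₁ , e₂ = ∧-true⁻ e in ==-sound e₁ , ==-sound e₂

-- Induced subgraphs and insertion of an edge

module _ (G : Graph n) where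

  forwards : Fin n → Fin n → Bool
  forwards u v = (u <ᶠ v) ∧ adj G u v

  -- The new edge is directed from `p` to `q`, the edges of `G` along the numbering. As any
  -- orientation bounds the size, `p` and `q` need not be compared.
  size-< : (H : Graph n) → (∀ {u v} → Adj G u v → Adj H u v) →
           ∀ {p q} → Adj H p q → adj G p q ≡ false → size G < size H
  size-< H G⊆H {p} {q} pq ¬pq = begin
    1 + size G                   ≡⟨ cong₂ _+_ (sym (##-arc p q)) (size≡## G) ⟩
    ## (arc p q) + ## forwards
      ≤⟨ ##-+mono (arc p q) forwards r
        (λ u v → 𝟙-join {arc p q u v} ∨-true⁺ˡ (∨-true⁺ʳ {arc p q u v}) (disjoint u v)) ⟩
    ## r                         ≤⟨ orientation≤size H r⊆H antisym ⟩
    size H                       ∎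
    where
    open ≤-Reasoning
    r : Fin n → Fin n → Bool
    r u v = arc p q u v ∨ forwards u v
    disjoint : ∀ u v → arc p q u v ≡ true → forwards u v ≡ true → ⊥
    disjoint u v e f with refl , refl ← arc⁻ {p = p} {q} e = false≢true ¬pq (proj₂ (∧-true⁻ {u <ᶠ v} f))
    r⊆H : ∀ {u v} → r u v ≡ true → Adj H u v
    r⊆H {u} {v} e with ∨-true⁻ {arc p q u v} e
    ... | inj₁ a with refl , refl ← arc⁻ {p = p} {q} a = pq
    ... | inj₂ f = G⊆H (proj₂ (∧-true⁻ {u <ᶠ v} f))
    antisym : ∀ {u v} → r u v ≡ true → r v u ≡ true → ⊥
    antisym {u} {v} e e′ with ∨-true⁻ {arc p q u v} e | ∨-true⁻ {arc p q v u} e′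
    ... | inj₁ a | inj₁ a′ with refl , refl ← arc⁻ {p = p} {q} a | refl , _ ← arc⁻ {p = p} {q} a′ = Adj⇒≢ H pq refl
    ... | inj₁ a | inj₂ f′ with refl , refl ← arc⁻ {p = p} {q} a = false≢true ¬pq
        (adj-sym G (proj₂ (∧-true⁻ {v <ᶠ u} f′)))
    ... | inj₂ f | inj₁ a′ with refl , refl ← arc⁻ {p = p} {q} a′ = false≢true ¬pq
        (adj-sym G (proj₂ (∧-true⁻ {u <ᶠ v} f)))
    ... | inj₂ f | inj₂ f′ = <-asym {toℕ u} {toℕ v} (<ᵇ-true⇒< (proj₁ (∧-true⁻ {u <ᶠ v} f)))
        (<ᵇ-true⇒< (proj₁ (∧-true⁻ {v <ᶠ u} f′)))

  size-mono : (H : Graph n) → (∀ {u v} → Adj G u v → Adj H u v) → size G ≤ size H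
  size-mono H G⊆H = begin
    size G                               ≡⟨ size≡## G ⟩
    ## forwards                          ≤⟨ sum-mono (λ u → sum-mono λ v → 𝟙-mono {forwards u v} (λ e →
                                              let u<v , uv = ∧-true⁻ {u <ᶠ v} e in ∧-true⁺ u<v (G⊆H {u} {v} uv))) ⟩
    ## (λ u v → (u <ᶠ v) ∧ adj H u v)    ≡⟨ size≡## H ⟨
    size H                               ∎
    where open ≤-Reasoning

  restrict : Subset n → Graph n
  restrict X = record
    { adj    = λ u v → adj G u v ∧ (lookup X u ∧ lookup X v)
    ; sym    = λ u v → cong₂ _∧_ (Graph.sym G u v) (∧-comm (lookup X u) (lookup X v))
    ; irrefl = λ v → cong (_∧ (lookup X v ∧ lookup X v)) (Graph.irrefl G v)
    }

  restrict⁻ : ∀ X {u v} → Adj (restrict X) u v → Adj G u v × u ∈ X × v ∈ X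
  restrict⁻ X {u} {v} e =
    let e₁ , e₂ = ∧-true⁻ {adj G u v} e ; e₃ , e₄ = ∧-true⁻ {lookup X u} e₂
    in e₁ , lookup⇒[]= u X e₃ , lookup⇒[]= v X e₄

  restrict⁺ : ∀ X {u v} → Adj G u v → u ∈ X → v ∈ X → Adj (restrict X) u v
  restrict⁺ X uv u∈X v∈X = ∧-true⁺ uv (∧-true⁺ ([]=⇒lookup u∈X) ([]=⇒lookup v∈X))

  insert : {p q : Fin n} → p ≢ q → Graph n
  insert {p} {q} p≢q = record
    { adj    = λ u v → (arc p q u v ∨ arc p q v u) ∨ adj G u v
    ; sym    = λ u v → cong₂ _∨_ (∨-comm (arc p q u v) (arc p q v u)) (Graph.sym G u v)
    ; irrefl = loopless
    }
    where
    loopless : ∀ v → (arc p q v v ∨ arc p q v v) ∨ adj G v v ≡ false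
    loopless v with arc p q v v in e
    ... | true  with refl , refl ← arc⁻ {p = p} {q} e = ⊥-elim (p≢q refl)
    ... | false = Graph.irrefl G v

  module _ {p q : Fin n} (p≢q : p ≢ q) where

    insert-new : Adj (insert p≢q) p q
    insert-new rewrite ==-refl p | ==-refl q = refl

    insert-old : ∀ {u v} → Adj G u v → Adj (insert p≢q) u v
    insert-old {u} {v} = ∨-true⁺ʳ {arc p q u v ∨ arc p q v u}

    insert⁻ : ∀ {u v} → Adj (insert p≢q) u v → (p ≡ u × q ≡ v) ⊎ (p ≡ v × q ≡ u) ⊎ Adj G u v
    insert⁻ {u} {v} e with ∨-true⁻ {arc p q u v ∨ arc p q v u} e
    ... | inj₂ g = inj₂ (inj₂ g)
    ... | inj₁ a with ∨-true⁻ {arc p q u v} a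
    ... | inj₁ b = inj₁ (arc⁻ b)
    ... | inj₂ b = inj₂ (inj₁ (arc⁻ b))

    size-insert : size (insert p≢q) ≤ suc (size G)
    size-insert = begin
      size (insert p≢q)                                   ≤⟨ size≤orientation (insert p≢q) {r} covers ⟩
      ## r
        ≤⟨ ##-mono+ r (arc p q) forwards (λ u v → 𝟙-split (∨-true⁻ {arc p q u v})) ⟩
      ## (arc p q) + ## forwards                          ≡⟨ cong₂ _+_ (##-arc p q) (sym (size≡## G)) ⟩
      suc (size G)                                        ∎
      where
      open ≤-Reasoning
      r : Fin n → Fin n → Bool
      r u v = arc p q u v ∨ forwards u v
      arc-refl : arc p q p q ≡ true
      arc-refl = ∧-true⁺ (==-refl p) (==-refl q)
      covers : ∀ {u v} → Adj (insert p≢q) u v → r u v ≡ true ⊎ r v u ≡ true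
      covers {u} {v} e with insert⁻ e
      ... | inj₁ (refl , refl)        = inj₁ (∨-true⁺ˡ arc-refl)
      ... | inj₂ (inj₁ (refl , refl)) = inj₂ (∨-true⁺ˡ arc-refl)
      ... | inj₂ (inj₂ g) with <-cmp (toℕ u) (toℕ v)
      ... | tri< l _ _ = inj₁ (∨-true⁺ʳ {arc p q u v} (∧-true⁺ (<⇒<ᵇ-true l) g))
      ... | tri≈ _ l _ = ⊥-elim (Adj⇒≢ G g (toℕ-injective l))
      ... | tri> _ _ l = inj₂ (∨-true⁺ʳ {arc p q v u} (∧-true⁺ (<⇒<ᵇ-true l) (adj-sym G g)))

-- Steiner trees

empty : ∀ n → Graph n
empty n = record { adj = λ _ _ → false ; sym = λ _ _ → refl ; irrefl = λ _ → refl }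

size-empty : ∀ n → size (empty n) ≤ 0
size-empty n = ≤-trans (size≤orientation (empty n) {λ _ _ → false} λ ())
  (≤-reflexive (trans (sum-cong-≗ {n} (λ _ → sum-replicate-zero n)) (sum-replicate-zero n)))

-- For X = ⁅ r ⁆ this is a decidable form of "S lies in a tree with at most k
-- edges that contains r".
Grows : Graph n → Subset n → ℕ → Subset n → Set
Grows G S zero    X = S ⊆ X
Grows G S (suc k) X = Grows G S k X ⊎
  ∃[ p ] ∃[ q ] p ∈ X × Adj G p q × Grows G S k (X ∪ ⁅ q ⁆)

Spans : Graph n → Subset n → ℕ → Set
Spans G S k = ∃[ r ] Grows G S k ⁅ r ⁆

SteinerTree : Graph n → Subset n → ℕ → Set
SteinerTree G S k = Σ[ H ∈ Subgraph G ] Connected H × S ⊆ vertices H × size (edges H) ≡ k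

crossing : ∀ (E : Graph n) {X a b} → Star (Adj E) a b → a ∈ X → b ∉ X →
           ∃[ p ] ∃[ q ] p ∈ X × q ∉ X × Adj E p q
crossing E ε a∈X a∉X = contradiction a∈X a∉X
crossing E {X} {a} (_◅_ {j = c} ac cb) a∈X b∉X with c ∈? X
... | yes c∈X = crossing E cb c∈X b∉X
... | no  c∉X = a , c , a∈X , c∉X , ac

module _ {n} (G : Graph n) (S : Subset n) where

  grows? : ∀ k X → Dec (Grows G S k X)
  grows? zero    X = S ⊆? X
  grows? (suc k) X = grows? k X ⊎-dec
    any? λ p → any? λ q → (p ∈? X) ×-dec ((adj G p q Bool.≟ true) ×-dec grows? k (X ∪ ⁅ q ⁆))

  spans? : ∀ k → Dec (Spans G S k)
  spans? k = any? λ r → grows? k ⁅ r ⁆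

  grows-≤ : ∀ {j k X} → j ≤ k → Grows G S j X → Grows G S k X
  grows-≤ {zero}  {zero}  _ g = g
  grows-≤ {zero}  {suc k} _ g = inj₁ (grows-≤ {zero} {k} z≤n g)
  grows-≤ {suc j} {suc k} (s≤s l) (inj₁ g) = inj₁ (grows-≤ l g)
  grows-≤ {suc j} {suc k} (s≤s l) (inj₂ (p , q , p∈X , pq , g)) =
    inj₂ (p , q , p∈X , pq , grows-≤ l g)

  grows-⊆ : ∀ {k X Y} → X ⊆ Y → Grows G S k X → Grows G S k Y
  grows-⊆ {zero}  X⊆Y g = X⊆Y ∘ g
  grows-⊆ {suc k} X⊆Y (inj₁ g) = inj₁ (grows-⊆ X⊆Y g)
  grows-⊆ {suc k} {X} {Y} X⊆Y (inj₂ (p , q , p∈X , pq , g)) =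
    inj₂ (p , q , X⊆Y p∈X , pq , grows-⊆ (x∈p∪q⁺ ∘ Sum.map₁ X⊆Y ∘ x∈p∪q⁻ X ⁅ q ⁆) g)

  -- The potential is the number of edges of `H` inside the grown set `X`. While `X` misses a vertex
  -- of `S`, connectedness yields an edge of `H` leaving `X`, and absorbing its far end raises the
  -- potential. Hence `size E` steps suffice, even if `H` has cycles, and growth can start at any
  -- vertex of `S`.
  steinerTree⇒grows : ∀ {k a} → SteinerTree G S k → a ∈ S → Grows G S k ⁅ a ⁆
  steinerTree⇒grows {k} {a} (H , connected , S⊆H , refl) a∈S =
    grow k ⁅ a ⁆ (x∈⁅x⁆ a) (m≤m+n k _)
    where
    E = edges H
    grow : ∀ k X → a ∈ X → size E ≤ k + size (restrict E X) → Grows G S k X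
    grow k X a∈X enough with any? (λ b → (b ∈? S) ×-dec ¬? (b ∈? X))
    ... | no ∄b = grows-≤ {zero} {k} z≤n λ {b} b∈S → decidable-stable (b ∈? X) λ b∉X → ∄b (b , b∈S , b∉X)
    ... | yes (b , b∈S , b∉X)
      with p , q , p∈X , q∉X , pq ← crossing E (connected (S⊆H a∈S) (S⊆H b∈S)) a∈X b∉X = case-k k enough
      where
      Y = X ∪ ⁅ q ⁆
      more : size (restrict E X) < size (restrict E Y)
      more = size-< (restrict E X) (restrict E Y)
        (λ uv → let e , u∈X , v∈X = restrict⁻ E X uv in restrict⁺ E Y e (p⊆p∪q _ u∈X) (p⊆p∪q _ v∈X))
        (restrict⁺ E Y pq (p⊆p∪q _ p∈X) (q⊆p∪q _ _ (x∈⁅x⁆ q)))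
        (Bool.¬-not λ e → q∉X (proj₂ (proj₂ (restrict⁻ E X e))))
      at-most : size (restrict E Y) ≤ size E
      at-most = size-mono (restrict E Y) E (proj₁ ∘ restrict⁻ E Y)
      case-k : ∀ k → size E ≤ k + size (restrict E X) → Grows G S k X
      case-k zero    enough = contradiction (≤-trans more (≤-trans at-most enough)) (n≮n _)
      case-k (suc k) enough = inj₂ (p , q , p∈X , Subgraph.sub H pq ,
        grow k Y (p⊆p∪q _ a∈X) (≤-trans enough (≤-trans (≤-reflexive (sym (+-suc k _))) (+-monoʳ-≤ k more))))

  -- The size is only bounded, because idle steps and steps along an edge already present add
  -- nothing.
  grows⇒steinerTree : ∀ {k} (H : Subgraph G) → Connected H → Grows G S k (vertices H) →
                      ∃[ j ] j ≤ k + size (edges H) × SteinerTree G S j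
  grows⇒steinerTree {zero}  H c S⊆H      = size (edges H) , ≤-refl , H , c , S⊆H , refl
  grows⇒steinerTree {suc k} H c (inj₁ g) =
    let j , j≤ , t = grows⇒steinerTree H c g in j , m≤n⇒m≤1+n j≤ , t
  grows⇒steinerTree {suc k} H c (inj₂ (p , q , p∈X , pq , g)) =
    let j , j≤ , t = grows⇒steinerTree H⁺ connected g
    in j , ≤-trans j≤ (≤-trans (+-monoʳ-≤ k (size-insert (edges H) p≢q)) (≤-reflexive (+-suc k _))) , t
    where
    p≢q = Adj⇒≢ G pq
    X = vertices H
    E⁺ = insert (edges H) p≢q
    q∈ : q ∈ X ∪ ⁅ q ⁆
    q∈ = q⊆p∪q X _ (x∈⁅x⁆ q)
    ends⁺ : ∀ {u v} → Adj E⁺ u v → u ∈ X ∪ ⁅ q ⁆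
    ends⁺ e with insert⁻ (edges H) p≢q e
    ... | inj₁ (refl , _)        = p⊆p∪q _ p∈X
    ... | inj₂ (inj₁ (_ , refl)) = q∈
    ... | inj₂ (inj₂ uv)         = p⊆p∪q _ (Subgraph.ends H uv)
    sub⁺ : ∀ {u v} → Adj E⁺ u v → Adj G u v
    sub⁺ e with insert⁻ (edges H) p≢q e
    ... | inj₁ (refl , refl)        = pq
    ... | inj₂ (inj₁ (refl , refl)) = adj-sym G pq
    ... | inj₂ (inj₂ uv)            = Subgraph.sub H uv
    H⁺ : Subgraph G
    H⁺ = record { vertices = X ∪ ⁅ q ⁆ ; edges = E⁺ ; sub = sub⁺ ; ends = ends⁺ }
    old : ∀ {u v} → u ∈ X → v ∈ X → Star (Adj E⁺) u v
    old u∈X v∈X = Star.map (insert-old (edges H) p≢q) (c u∈X v∈X)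
    new : Adj E⁺ p q
    new = insert-new (edges H) p≢q
    to-p : ∀ {u} → u ∈ X ∪ ⁅ q ⁆ → Star (Adj E⁺) u p
    to-p u∈ with x∈p∪q⁻ X ⁅ q ⁆ u∈
    ... | inj₁ u∈X = old u∈X p∈X
    ... | inj₂ u∈q with refl ← x∈⁅y⁆⇒x≡y q u∈q = adj-sym E⁺ new ◅ ε
    from-p : ∀ {u} → u ∈ X ∪ ⁅ q ⁆ → Star (Adj E⁺) p u
    from-p u∈ with x∈p∪q⁻ X ⁅ q ⁆ u∈
    ... | inj₁ u∈X = old p∈X u∈X
    ... | inj₂ u∈q with refl ← x∈⁅y⁆⇒x≡y q u∈q = new ◅ ε
    connected : Connected H⁺
    connected u∈ v∈ = to-p u∈ ◅◅ from-p v∈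

  spans⇒steinerTree : ∀ {k} → Spans G S k → ∃[ j ] j ≤ k × SteinerTree G S j
  spans⇒steinerTree {k} (r , g) =
    let j , j≤ , t = grows⇒steinerTree {k} H connected g
    in j , ≤-trans j≤ (≤-trans (+-monoʳ-≤ k (size-empty n)) (≤-reflexive (+-identityʳ k))) , t
    where
    H : Subgraph G
    H = record { vertices = ⁅ r ⁆ ; edges = empty _ ; sub = λ () ; ends = λ () }
    connected : Connected H
    connected u∈ v∈ with refl ← x∈⁅y⁆⇒x≡y r u∈ | refl ← x∈⁅y⁆⇒x≡y r v∈ = ε

  spans-≤ : ∀ {j k} → j ≤ k → Spans G S j → Spans G S k
  spans-≤ j≤k (r , g) = r , grows-≤ j≤k g

  steinerTree⇒spans : ∀ {k a} → a ∈ S → SteinerTree G S k → Spans G S k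
  steinerTree⇒spans a∈S t = _ , steinerTree⇒grows t a∈S

  distance≤ : ∀ {k w} → Spans G S k → IsSteinerDistance G S w → w ≤⁺ [ k ]
  distance≤ {w = [ m ]} s (_ , least) = let j , j≤k , t = spans⇒steinerTree s in [ ≤-trans (least j t) j≤k ]
  distance≤ {w = ⊤⁺} s none = let j , _ , t = spans⇒steinerTree s in contradiction t (none j)

  distance≡0 : Spans G S 0 → IsSteinerDistance G S [ 0 ]
  distance≡0 s with zero , _ , t ← spans⇒steinerTree s = t , λ _ _ → z≤n

  distance≡suc : ∀ {k a} → a ∈ S → Spans G S (suc k) → ¬ Spans G S k → IsSteinerDistance G S [ suc k ]
  distance≡suc {k} a∈S s ¬s =
    let j , j≤ , t = spans⇒steinerTree s in subst SteinerTree′ (≤-antisym j≤ (large t)) t , λ _ → large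
    where
    SteinerTree′ = SteinerTree G S
    large : ∀ {j} → SteinerTree G S j → suc k ≤ j
    large t = ≰⇒> λ j≤k → ¬s (spans-≤ j≤k (steinerTree⇒spans a∈S t))

-- The Steiner 3-diameter in terms of spanned triples

least : {P : ℕ → Set} → (∀ k → Dec (P k)) → ∀ k → P k → ∃[ m ] IsMin P [ m ]
least P? zero p = zero , p , λ _ _ → z≤n
least {P} P? (suc k) p with P? 0
... | yes p₀ = zero , p₀ , λ _ _ → z≤n
... | no ¬p₀ with m , pm , low ← least {P ∘ suc} (P? ∘ suc) k p =
  suc m , pm , λ { zero p₀ → contradiction p₀ ¬p₀ ; (suc j) pj → s≤s (low j pj) }

card⇒∈ : ∀ (S : Subset n) {k} → ∣ S ∣ ≡ suc k → ∃[ a ] a ∈ S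
card⇒∈ {n} S e with nonempty? S
... | yes ne = ne
... | no ¬ne rewrite Empty-unique ¬ne = contradiction (trans (sym (∣⊥∣≡0 n)) e) λ ()

TriplesSpan : Graph n → ℕ → Set
TriplesSpan G k = ∀ S → ∣ S ∣ ≡ 3 → Spans G S k

-- The failing triple is returned as data, since it will realise the diameter.
triplesSpan? : (G : Graph n) → ∀ k → TriplesSpan G k ⊎ ∃[ S ] ∣ S ∣ ≡ 3 × ¬ Spans G S k
triplesSpan? G k with anySubset? (λ S → (∣ S ∣ ≟ℕ 3) ×-dec ¬? (spans? G S k))
... | yes ∃S = inj₂ ∃S
... | no  ∄S = inj₁ λ S e → decidable-stable (spans? G S k) λ ¬s → ∄S (S , e , ¬s)

triplesSpan-dec : (G : Graph n) → ∀ k → Dec (TriplesSpan G k)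
triplesSpan-dec G k with triplesSpan? G k
... | inj₁ t = yes t
... | inj₂ (S , e , ¬s) = no λ t → ¬s (t S e)

-- The diameter is the least `m` for which all triples span: a triple that fails for `m - 1` has
-- distance exactly `m`.
triplesSpan⇒sdiam≤ : ∀ {G : Graph n} {k} → ∃[ S ] ∣ S ∣ ≡ 3 → TriplesSpan G k →
                     ∃[ w ] IsSteiner3Diameter G w × w ≤⁺ [ k ]
triplesSpan⇒sdiam≤ {G = G} {k} (S₀ , e₀) t with least (triplesSpan-dec G) k t
... | m , tm , low = [ m ] , (attained m tm low , λ { w (S , e , d) → distance≤ G S (tm S e) d }) , [ low k t ]
  where
  attained : ∀ m → TriplesSpan G m → (∀ j → TriplesSpan G j → m ≤ j) → Σ[ S ∈ Subset _ ] ∣ S ∣ ≡ 3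
      × IsSteinerDistance G S [ m ]
  -- Three vertices never fit into one, so this case is impossible; answering it with any triple
  -- avoids proving that.
  attained zero    tm low = S₀ , e₀ , distance≡0 G S₀ (tm S₀ e₀)
  attained (suc m) tm low with triplesSpan? G m
  ... | inj₁ t = contradiction (low m t) (n≮n m)
  ... | inj₂ (S , e , ¬s) = S , e , distance≡suc G S (proj₂ (card⇒∈ S e)) (tm S e) ¬s

-- Whether any tree contains `S` is an unbounded search, so excluded middle is used under a double
-- negation, which the decidable goal absorbs. If no tree exists, ∞ itself competes in the maximum,
-- contradicting `w ≤⁺ [ k ]`.
sdiam≤⇒triplesSpan : ∀ {G : Graph n} {k} → ∃[ w ] IsSteiner3Diameter G w × w ≤⁺ [ k ] → TriplesSpan G k
sdiam≤⇒triplesSpan {G = G} {k} (w , (_ , max) , w≤k) S e =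
  decidable-stable (spans? G S k) λ ¬s → ¬¬-excluded-middle {A = ∃[ j ] Spans G S j} λ
    { (yes (j , s)) → ¬s (finite j s)
    ; (no ∄j) → ∞≰ (≤⁺-trans ≤-trans (max ⊤⁺ (S , e , λ j t → ∄j (j , spans t))) w≤k)
    }
  where
  spans : ∀ {j} → SteinerTree G S j → Spans G S j
  spans = steinerTree⇒spans G S (proj₂ (card⇒∈ S e))
  ∞≰ : ∀ {m} → ¬ (⊤⁺ ≤⁺ [ m ])
  ∞≰ ()
  finite : ∀ j → Spans G S j → Spans G S k
  finite j s with least (spans? G S) j s
  ... | m , sm , low with j′ , j′≤m , t ← spans⇒steinerTree G S sm =
    spans-≤ G S ([≤]-injective (≤⁺-trans ≤-trans
        (max [ j′ ] (S , e , t , λ i t′ → ≤-trans j′≤m (low i (spans t′)))) w≤k)) (spans t)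

-- Local structure when three edges span every triple

∈-tabulate⁺ : (p : Fin n → Bool) {x : Fin n} → p x ≡ true → x ∈ tabulate p
∈-tabulate⁺ p {x} px = lookup⇒[]= x _ (trans (lookup∘tabulate p x) px)

pair! : {a b : Fin n} → a ≢ b → Unique (a ∷ b ∷ [])
pair! a≢b = (a≢b ∷ []) ∷ [] ∷ []

triple! : {a b c : Fin n} → a ≢ b → a ≢ c → b ≢ c → Unique (a ∷ b ∷ c ∷ [])
triple! a≢b a≢c b≢c = (a≢b ∷ a≢c ∷ []) ∷ pair! b≢c

triple : {a b c : Fin n} → a ≢ b → a ≢ c → b ≢ c →
         ∃[ S ] ∣ S ∣ ≡ 3 × a ∈ S × b ∈ S × c ∈ S
triple {a = a} {b} {c} a≢b a≢c b≢c =
  tabulate p , trans (∣tabulate∣ p) (≤-antisym at-most (length≤# (triple! a≢b a≢c b≢c) (pa ∷ pb ∷ pc ∷ [])))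
  , ∈-tabulate⁺ p pa , ∈-tabulate⁺ p pb , ∈-tabulate⁺ p pc
  where
  p = λ x → (a == x) ∨ ((b == x) ∨ (c == x))
  pa : p a ≡ true
  pa = ∨-true⁺ˡ (==-refl a)
  pb : p b ≡ true
  pb = ∨-true⁺ʳ {a == b} (∨-true⁺ˡ (==-refl b))
  pc : p c ≡ true
  pc = ∨-true⁺ʳ {a == c} (∨-true⁺ʳ {b == c} (==-refl c))
  open ≤-Reasoning
  at-most = begin
    # p
      ≤⟨ sum-mono (λ x → ≤-trans (𝟙-split {b = a == x} (∨-true⁻ {a == x}))
        (+-monoʳ-≤ (δ a x) (𝟙-split (∨-true⁻ {b == x})))) ⟩
    sum (λ x → δ a x + (δ b x + δ c x))
      ≡⟨ trans (∑-distrib-+ (δ a) _) (cong (sum (δ a) +_) (∑-distrib-+ (δ b) (δ c))) ⟩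
    sum (δ a) + (sum (δ b) + sum (δ c))     ≡⟨ cong₂ _+_ (sum-δ a) (cong₂ _+_ (sum-δ b) (sum-δ c)) ⟩
    3                                       ∎

∈-∪⁅⁆⁻ : ∀ X {q y : Fin n} → y ∈ X ∪ ⁅ q ⁆ → y ∈ X ⊎ y ≡ q
∈-∪⁅⁆⁻ X {q} y∈ with x∈p∪q⁻ X ⁅ q ⁆ y∈
... | inj₁ y∈X = inj₁ y∈X
... | inj₂ y∈q = inj₂ (x∈⁅y⁆⇒x≡y q y∈q)

-- Idle steps can be postponed: while `S` is not covered, some step adds a vertex, and it may be
-- taken first.
grow-step : (G : Graph n) (S : Subset n) {X : Subset n} → Grows G S (suc k) X → ¬ S ⊆ X →
            ∃[ p ] ∃[ q ] p ∈ X × Adj G p q × Grows G S k (X ∪ ⁅ q ⁆)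
grow-step         G S (inj₂ g) _ = g
grow-step {k = zero}  G S (inj₁ g) S⊈X = contradiction (λ {x} → g {x}) S⊈X
grow-step {k = suc k} G S (inj₁ g) S⊈X =
  let p , q , p∈X , pq , g′ = grow-step G S g S⊈X in p , q , p∈X , pq , inj₁ g′

module _ (G : Graph n) where

  separated : ∀ {v x y} → Adj G v x → adj G v y ≡ false → x ≢ y
  separated vx ¬vy refl = false≢true ¬vy vx

  near? : ∀ a x → Dec (∃[ u ] Adj G a u × Adj G u x)
  near? a x = any? λ u → (adj G a u Bool.≟ true) ×-dec (adj G u x Bool.≟ true)

  module _ (spans : TriplesSpan G 3) where

    -- Growing from `a` adds three vertices. The first is neither `b` nor `c`, so it is `u`; the
    -- other two are `b` and `c` in some order. As `a` is adjacent to neither, the earlier hangs on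
    -- `u`, the later on `u` or on the earlier one.
    branching : ∀ {a b c} → a ≢ b → a ≢ c → b ≢ c → adj G a b ≡ false → adj G a c ≡ false →
                ∃[ u ] Adj G a u × (Adj G u b × (Adj G u c ⊎ Adj G b c) ⊎ Adj G u c × (Adj G u b ⊎ Adj G b c))
    branching {a} {b} {c} a≢b a≢c b≢c ¬ab ¬ac
      with S , ∣S∣≡3 , a∈S , b∈S , c∈S ← triple a≢b a≢c b≢c
      -- `Spans` leaves the root unspecified, so the tree is formed first and then regrown from `a`.
      with _ , j≤3 , tree ← spans⇒steinerTree G S (spans S ∣S∣≡3)
      with _ , x , p∈ , ax , g ← grow-step G S (grows-≤ G S j≤3 (steinerTree⇒grows G S tree a∈S))
          (λ S⊆a → a≢b (sym (x∈⁅y⁆⇒x≡y a (S⊆a b∈S))))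
      with refl ← x∈⁅y⁆⇒x≡y a p∈ = second (grow-step G S g (λ S⊆X → b∉X₁ (S⊆X b∈S)))
      where
      Goal = ∃[ u ] Adj G a u × (Adj G u b × (Adj G u c ⊎ Adj G b c) ⊎ Adj G u c × (Adj G u b ⊎ Adj G b c))
      ∈X₁ : ∀ {w} → w ∈ ⁅ a ⁆ ∪ ⁅ x ⁆ → w ≡ a ⊎ w ≡ x
      ∈X₁ w∈ with ∈-∪⁅⁆⁻ ⁅ a ⁆ w∈
      ... | inj₁ w∈a = inj₁ (x∈⁅y⁆⇒x≡y a w∈a)
      ... | inj₂ w≡x = inj₂ w≡x
      b∉X₁ : b ∉ ⁅ a ⁆ ∪ ⁅ x ⁆
      b∉X₁ b∈ = [ (λ b≡a → a≢b (sym b≡a)) , (λ { refl → false≢true ¬ab ax }) ]′ (∈X₁ b∈)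
      c∉X₁ : c ∉ ⁅ a ⁆ ∪ ⁅ x ⁆
      c∉X₁ c∈ = [ (λ c≡a → a≢c (sym c≡a)) , (λ { refl → false≢true ¬ac ax }) ]′ (∈X₁ c∈)
      not-both : ∀ {y} → b ∈ (⁅ a ⁆ ∪ ⁅ x ⁆) ∪ ⁅ y ⁆ → ¬ c ∈ (⁅ a ⁆ ∪ ⁅ x ⁆) ∪ ⁅ y ⁆
      not-both b∈ c∈ with ∈-∪⁅⁆⁻ _ b∈ | ∈-∪⁅⁆⁻ _ c∈
      ... | inj₁ b∈X | _ = b∉X₁ b∈X
      ... | inj₂ _ | inj₁ c∈X = c∉X₁ c∈X
      ... | inj₂ refl | inj₂ refl = b≢c refl
      after : ∀ {p v} → p ∈ ⁅ a ⁆ ∪ ⁅ x ⁆ → Adj G p v → adj G a v ≡ false → Adj G x v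
      after p∈ pv ¬av with ∈X₁ p∈
      ... | inj₁ refl = ⊥-elim (false≢true ¬av pv)
      ... | inj₂ refl = pv
      second : ∃[ p ] ∃[ y ] p ∈ ⁅ a ⁆ ∪ ⁅ x ⁆ × Adj G p y × Grows G S 1 ((⁅ a ⁆ ∪ ⁅ x ⁆) ∪ ⁅ y ⁆) → Goal
      second (p , y , p∈ , py , g) = third (grow-step G S g (λ S⊆X → not-both (S⊆X b∈S) (S⊆X c∈S)))
        where
        last : ∀ {q v} → q ∈ (⁅ a ⁆ ∪ ⁅ x ⁆) ∪ ⁅ y ⁆ → Adj G q v → adj G a v ≡ false → Adj G x v ⊎ Adj G y v
        last q∈ qv ¬av with ∈-∪⁅⁆⁻ _ q∈
        ... | inj₁ q∈X = inj₁ (after q∈X qv ¬av)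
        ... | inj₂ refl = inj₂ qv
        third : ∃[ q ] ∃[ z ] q ∈ (⁅ a ⁆ ∪ ⁅ x ⁆) ∪ ⁅ y ⁆ × Adj G q z × S ⊆
            ((⁅ a ⁆ ∪ ⁅ x ⁆) ∪ ⁅ y ⁆) ∪ ⁅ z ⁆ → Goal
        third (q , z , q∈ , qz , S⊆) with ∈-∪⁅⁆⁻ _ (S⊆ b∈S) | ∈-∪⁅⁆⁻ _ (S⊆ c∈S)
        ... | inj₂ refl | inj₂ refl = ⊥-elim (b≢c refl)
        ... | inj₁ b∈ | inj₁ c∈ = ⊥-elim (not-both b∈ c∈)
        ... | inj₂ refl | inj₁ c∈ with ∈-∪⁅⁆⁻ _ c∈
        ...   | inj₁ c∈X = ⊥-elim (c∉X₁ c∈X)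
        ...   | inj₂ refl = x , ax , inj₂ (after p∈ py ¬ac , [ inj₁ , inj₂ ∘ adj-sym G ]′ (last q∈ qz ¬ab))
        third (q , z , q∈ , qz , S⊆) | inj₁ b∈ | inj₂ refl with ∈-∪⁅⁆⁻ _ b∈
        ...   | inj₁ b∈X = ⊥-elim (b∉X₁ b∈X)
        ...   | inj₂ refl = x , ax , inj₁ (after p∈ py ¬ab , last q∈ qz ¬ac)

    branching-near : ∀ {a b c} → a ≢ b → a ≢ c → b ≢ c → adj G a b ≡ false → adj G a c ≡ false →
                     ∃[ u ] Adj G a u × (Adj G u b ⊎ Adj G u c)
    branching-near {a} {b} {c} a≢b a≢c b≢c ¬ab ¬ac = near (branching a≢b a≢c b≢c ¬ab ¬ac)
      where
      near : ∃[ u ] Adj G a u × (Adj G u b × (Adj G u c ⊎ Adj G b c) ⊎ Adj G u c × (Adj G u b ⊎ Adj G b c)) →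
             ∃[ u ] Adj G a u × (Adj G u b ⊎ Adj G u c)
      near (u , au , inj₁ (ub , _)) = u , au , inj₁ ub
      near (u , au , inj₂ (uc , _)) = u , au , inj₂ uc

    common-neighbour : ∀ {a b c} → a ≢ b → a ≢ c → b ≢ c →
                       adj G a b ≡ false → adj G a c ≡ false → adj G b c ≡ false →
                       ∃[ u ] Adj G a u × Adj G u b × Adj G u c
    common-neighbour {a} {b} {c} a≢b a≢c b≢c ¬ab ¬ac ¬bc = common (branching a≢b a≢c b≢c ¬ab ¬ac)
      where
      common : ∃[ u ] Adj G a u × (Adj G u b × (Adj G u c ⊎ Adj G b c) ⊎ Adj G u c × (Adj G u b ⊎ Adj G b c)) →
               ∃[ u ] Adj G a u × Adj G u b × Adj G u c
      common (u , au , inj₁ (ub , inj₁ uc)) = u , au , ub , uc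
      common (u , au , inj₂ (uc , inj₁ ub)) = u , au , ub , uc
      common (u , au , inj₁ (_ , inj₂ bc))  = ⊥-elim (false≢true ¬bc bc)
      common (u , au , inj₂ (_ , inj₂ bc))  = ⊥-elim (false≢true ¬bc bc)

    -- If `x₀` has no common neighbour with `a`, then in the tree for `a`, `x₀` and `x` it must be
    -- `x` that is adjacent to `u`.
    distance-two : ∀ a → ∃[ x₀ ] ∀ {x} → x ≢ x₀ → a ≢ x → adj G a x ≡ false → ∃[ u ] Adj G a u × Adj G u x
    distance-two a with any? (λ x → ¬? (a ≟ x) ×-dec ((adj G a x Bool.≟ false) ×-dec ¬? (near? a x)))
    -- With no exception to name, `a` is a dummy, already excluded by `a ≢ x`.
    ... | no ∄x = a , λ {x} _ a≢x ¬ax → decidable-stable (near? a x) λ ¬near → ∄x (x , a≢x , ¬ax , ¬near)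
    ... | yes (x₀ , a≢x₀ , ¬ax₀ , ¬near) = x₀ , λ x≢x₀ a≢x ¬ax → near
        (branching-near a≢x₀ a≢x (≢-sym x≢x₀) ¬ax₀ ¬ax)
      where
      near : ∀ {x} → ∃[ u ] Adj G a u × (Adj G u x₀ ⊎ Adj G u x) → ∃[ u ] Adj G a u × Adj G u x
      near (u , au , inj₁ ux₀) = contradiction (u , au , ux₀) ¬near
      near (u , au , inj₂ ux)  = u , au , ux

-- The classes rank the vertices; vertices in no class come last.
level : List (Fin n → Bool) → Fin n → ℕ
level []       x = 0
level (c ∷ cs) x = if c x then 0 else suc (level cs x)

-- `there` asks nothing of `y`: if `y` already lies in the class, it ranks even earlier. So
-- non-membership has to be known for `x` alone.
data Before {n} : List (Fin n → Bool) → Fin n → Fin n → Set where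
  here  : ∀ {c cs y x} → c y ≡ true → c x ≡ false → Before (c ∷ cs) y x
  there : ∀ {c cs y x} → c x ≡ false → Before cs y x → Before (c ∷ cs) y x

before⇒< : ∀ {cs} {y x : Fin n} → Before cs y x → level cs y < level cs x
before⇒< (here cy ¬cx) rewrite cy | ¬cx = z<s
before⇒< {y = y} (there {c = c} ¬cx b) rewrite ¬cx with c y
... | true  = z<s
... | false = s≤s (before⇒< b)

module _ (G : Graph n) (cs : List (Fin n → Bool)) where

  below : Fin n → Fin n → Bool
  below x y = adj G x y ∧ (level cs y <ᵇ level cs x)

  down : Fin n → ℕ
  down x = # (below x)

  -- An edge is counted at its later end only, and not at all if its ends share a level: a coarse
  -- ranking may lose edges but never counts one twice.
  sum-down≤size : sum down ≤ size G
  sum-down≤size = orientation≤size G (λ {u} e → proj₁ (∧-true⁻ {adj G u _} e))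
    λ {u} {v} e e′ → <-asym (<ᵇ-true⇒< {level cs v} (proj₂ (∧-true⁻ {adj G u v} e)))
        (<ᵇ-true⇒< {level cs u} (proj₂ (∧-true⁻ {adj G v u} e′)))

  below⁺ : ∀ {x y} → Adj G x y → Before cs y x → below x y ≡ true
  below⁺ xy y<x = ∧-true⁺ xy (<⇒<ᵇ-true (before⇒< y<x))

  one≤down : ∀ {x y} → Adj G x y → Before cs y x → 1 ≤ down x
  one≤down {x} xy y<x = length≤# {p = below x} ([] ∷ []) (below⁺ xy y<x ∷ [])

  two≤down : ∀ {x y z} → y ≢ z → Adj G x y → Before cs y x → Adj G x z → Before cs z x → 2 ≤ down x
  two≤down {x} y≢z xy y<x xz z<x =
    length≤# {p = below x} (pair! y≢z) (below⁺ xy y<x ∷ below⁺ xz z<x ∷ [])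

-- Lower bounds

room : ∀ {d k m} → d + k ≤ n → m < k → d + m < n
room {d = d} d+k≤n m<k = ≤-trans (+-monoʳ-< d m<k) d+k≤n

-- The unit at `x₀` pays for the one vertex where the strong bound may fail; after summation it
-- costs 1.
except-at : ∀ {d k} {x x₀ : Fin n} → k ≤ d → (x ≢ x₀ → suc k ≤ d) → suc k ≤ d + δ x₀ x
except-at {d = d} {k} {x} {x₀} weak strong with x ≟ x₀
... | yes refl rewrite δ-refl x = ≤-trans (≤-reflexive (+-comm 1 k)) (+-monoˡ-≤ 1 weak)
... | no x≢x₀ = ≤-trans (strong x≢x₀) (m≤m+n d _)

twice-𝟙≤ : ∀ b {d} → (b ≡ true → 2 ≤ d) → 𝟙 b + 𝟙 b ≤ d
twice-𝟙≤ true  h = h refl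
twice-𝟙≤ false h = z≤n

twice-𝟙+≤ : ∀ {p : Fin n → Bool} {f g : Fin n → ℕ} {w} → p w ≡ false → (∀ {x} → w ≢ x → g x ≡ 0) → g w ≤ f w →
            (∀ {x} → p x ≡ true → 2 ≤ f x) → ∀ x → 𝟙 (p x) + 𝟙 (p x) + g x ≤ f x
twice-𝟙+≤ {p = p} {f} {g} {w} ¬pw g≡0 gw≤ h x with w ≟ x
... | yes refl rewrite ¬pw = gw≤
... | no w≢x rewrite g≡0 w≢x = ≤-trans (≤-reflexive (+-identityʳ _)) (twice-𝟙≤ (p x) h)

module _ (G : Graph n) (spans : TriplesSpan G 3) where

  -- A neighbour `x` of `v` has the earlier neighbour `v`. A second one is `w`, or else a common
  -- neighbour `u` of `w` and `x`, earlier than `x` by the class `adj G w` and distinct from `v`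
  -- because `w` is not adjacent to `v`. Only `x₀` may lack it.
  2degree≤1+size : ∀ {v} → degree G v + 2 ≡ n → degree G v + degree G v ≤ size G + 1
  2degree≤1+size {v} deg
    with w , ¬vw , v≢w ∷ [] ← ∃-nonneighbour G v (v ∷ []) (room (≤-reflexive deg) ≤-refl)
    with x₀ , near ← distance-two G spans w = begin
      degree G v + degree G v             ≡⟨ cong₂ _+_ (degree≡# G v) (degree≡# G v) ⟩
      # (adj G v) + # (adj G v)           ≡⟨ ∑-distrib-+ (𝟙 ∘ adj G v) _ ⟨
      sum (λ x → 𝟙 (adj G v x) + 𝟙 (adj G v x)) ≤⟨ sum-mono (λ x → twice-𝟙≤ (adj G v x) neighbour) ⟩
      sum (λ x → down G ρ x + δ x₀ x)     ≡⟨ ∑-distrib-+ (down G ρ) (δ x₀) ⟩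
      sum (down G ρ) + sum (δ x₀)         ≤⟨ +-mono-≤ (sum-down≤size G ρ) (≤-reflexive (sum-δ x₀)) ⟩
      size G + 1                          ∎
    where
    open ≤-Reasoning
    ρ = (v ==_) ∷ (w ==_) ∷ adj G w ∷ []
    ¬wv = adj-sym G ¬vw
    neighbour : ∀ {x} → Adj G v x → 2 ≤ down G ρ x + δ x₀ x
    neighbour {x} vx = except-at (one≤down G ρ xv v<x) (closer (adj G w x) refl)
      where
      xv = adj-sym G vx
      v≢x = Adj⇒≢ G vx
      w≢x = ≢-sym (separated G vx ¬vw)
      v<x : Before ρ v x
      v<x = here (==-refl v) (≢⇒== v≢x)
      closer : ∀ b → adj G w x ≡ b → x ≢ x₀ → 2 ≤ down G ρ x
      closer true wx _ = two≤down G ρ v≢w xv v<x (adj-sym G wx)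
        (there (≢⇒== v≢x) (here (==-refl w) (≢⇒== w≢x)))
      closer false ¬wx x≢ = let u , wu , ux = near x≢ w≢x ¬wx in
        two≤down G ρ (≢-sym (separated G wu ¬wv)) xv v<x (adj-sym G ux)
          (there (≢⇒== v≢x) (there (≢⇒== w≢x) (here wu ¬wx)))

  -- Branching from a neighbour of `v` towards `w₁` and `w₂` reaches one of them, and since their
  -- neighbourhoods form a single class it does not matter which. Hence no vertex is exceptional.
  -- The extra 1 is the edge between `w₁` and `w₂`, counted at `w₂`.
  2degree+1≤size-adjacent : ∀ {v w₁ w₂} →
    v ≢ w₁ → v ≢ w₂ → adj G v w₁ ≡ false → adj G v w₂ ≡ false → Adj G w₁ w₂ →
    degree G v + degree G v + 1 ≤ size G
  2degree+1≤size-adjacent {v} {w₁} {w₂} v≢w₁ v≢w₂ ¬vw₁ ¬vw₂ w₁w₂ = begin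
      degree G v + degree G v + 1
        ≡⟨ cong₂ _+_ (cong₂ _+_ (degree≡# G v) (degree≡# G v)) (sym (sum-δ w₂)) ⟩
      # (adj G v) + # (adj G v) + sum (δ w₂)  ≡⟨ cong (_+ sum (δ w₂)) (∑-distrib-+ (𝟙 ∘ adj G v) _) ⟨
      sum (λ x → 𝟙 (adj G v x) + 𝟙 (adj G v x)) + sum (δ w₂)
        ≡⟨ ∑-distrib-+ (λ x → 𝟙 (adj G v x) + 𝟙 (adj G v x)) (δ w₂) ⟨
      sum (λ x → 𝟙 (adj G v x) + 𝟙 (adj G v x) + δ w₂ x)
        ≤⟨ sum-mono (twice-𝟙+≤ {p = adj G v} {g = δ w₂} ¬vw₂ δ-≢ one neighbour) ⟩
      sum (down G ρ)                          ≤⟨ sum-down≤size G ρ ⟩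
      size G                                  ∎
    where
    open ≤-Reasoning
    ρ = (v ==_) ∷ (w₁ ==_) ∷ (w₂ ==_) ∷ (λ x → adj G w₁ x ∨ adj G w₂ x) ∷ []
    w₁≢w₂ = Adj⇒≢ G w₁w₂
    ¬w₁v = adj-sym G ¬vw₁
    ¬w₂v = adj-sym G ¬vw₂
    neighbour : ∀ {x} → Adj G v x → 2 ≤ down G ρ x
    neighbour {x} vx = second (adj G w₁ x) (adj G w₂ x) refl refl
      where
      xv = adj-sym G vx
      v≢x = Adj⇒≢ G vx
      w₁≢x = ≢-sym (separated G vx ¬vw₁)
      w₂≢x = ≢-sym (separated G vx ¬vw₂)
      second : ∀ b₁ b₂ → adj G w₁ x ≡ b₁ → adj G w₂ x ≡ b₂ → 2 ≤ down G ρ x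
      second true _ w₁x _ = two≤down G ρ v≢w₁ xv (here (==-refl v) (≢⇒== v≢x)) (adj-sym G w₁x)
        (there (≢⇒== v≢x) (here (==-refl w₁) (≢⇒== w₁≢x)))
      second false true _ w₂x = two≤down G ρ v≢w₂ xv (here (==-refl v) (≢⇒== v≢x)) (adj-sym G w₂x)
        (there (≢⇒== v≢x) (there (≢⇒== w₁≢x) (here (==-refl w₂) (≢⇒== w₂≢x))))
      second false false ¬w₁x ¬w₂x =
        third (branching-near G spans (≢-sym w₁≢x) (≢-sym w₂≢x) w₁≢w₂ (adj-sym G ¬w₁x) (adj-sym G ¬w₂x))
        where
        near-u : ∀ {u} → Adj G u w₁ ⊎ Adj G u w₂ → adj G w₁ u ∨ adj G w₂ u ≡ true
        near-u {u} = [ (λ uw₁ → ∨-true⁺ˡ (adj-sym G uw₁)) , (λ uw₂ → ∨-true⁺ʳ {adj G w₁ u} (adj-sym G uw₂)) ]′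
        v≢ : ∀ {u} → Adj G u w₁ ⊎ Adj G u w₂ → v ≢ u
        v≢ uw refl = [ false≢true ¬vw₁ , false≢true ¬vw₂ ]′ uw
        third : ∃[ u ] Adj G x u × (Adj G u w₁ ⊎ Adj G u w₂) → 2 ≤ down G ρ x
        third (u , xu , uw) = two≤down G ρ (v≢ uw) xv (here (==-refl v) (≢⇒== v≢x)) xu
          (there (≢⇒== v≢x) (there (≢⇒== w₁≢x) (there (≢⇒== w₂≢x) (here (near-u uw) (cong₂ _∨_ ¬w₁x ¬w₂x)))))
    one : δ w₂ w₂ ≤ down G ρ w₂
    one = ≤-trans (≤-reflexive (δ-refl w₂)) (one≤down G ρ (adj-sym G w₁w₂)
      (there (≢⇒== v≢w₂) (here (==-refl w₁) (≢⇒== w₁≢w₂))))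

  -- Here `w₁` acts as the single target and costs the exception `x₁`. As `w₂` lies in no class it
  -- comes last, after all of its neighbours, and contributes at least 2. The balance is + 2 - 1.
  2degree+1≤size-nonadjacent : ∀ {v w₁ w₂} → (∀ {x} → adj G v x ≡ false → x ≡ v ⊎ x ≡ w₁ ⊎ x ≡ w₂) →
    v ≢ w₁ → v ≢ w₂ → w₁ ≢ w₂ → adj G v w₁ ≡ false → adj G v w₂ ≡ false → adj G w₁ w₂ ≡ false →
    degree G v + 2 < n → (∀ u → degree G u ≤ degree G v) →
    degree G v + degree G v + 1 ≤ size G
  2degree+1≤size-nonadjacent {v} {w₁} {w₂} only v≢w₁ v≢w₂ w₁≢w₂ ¬vw₁ ¬vw₂ ¬w₁w₂ deg max
    with x₁ , near ← distance-two G spans w₁ = s≤s⁻¹ (begin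
      suc (degree G v + degree G v + 1)       ≡⟨ +-comm 1 _ ⟩
      degree G v + degree G v + 1 + 1         ≡⟨ +-assoc _ 1 1 ⟩
      degree G v + degree G v + (1 + 1)
        ≡⟨ cong₂ _+_ (cong₂ _+_ (degree≡# G v) (degree≡# G v)) (cong₂ _+_ (sym (sum-δ w₂)) (sym (sum-δ w₂))) ⟩
      # (adj G v) + # (adj G v) + (sum (δ w₂) + sum (δ w₂))
        ≡⟨ cong₂ _+_ (∑-distrib-+ (𝟙 ∘ adj G v) _) (∑-distrib-+ (δ w₂) _) ⟨
      sum (λ x → 𝟙 (adj G v x) + 𝟙 (adj G v x)) + sum (λ x → δ w₂ x + δ w₂ x)
        ≡⟨ ∑-distrib-+ (λ x → 𝟙 (adj G v x) + 𝟙 (adj G v x)) (λ x → δ w₂ x + δ w₂ x) ⟨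
      sum (λ x → 𝟙 (adj G v x) + 𝟙 (adj G v x) + (δ w₂ x + δ w₂ x))
        ≤⟨ sum-mono (twice-𝟙+≤ {p = adj G v} {g = λ x → δ w₂ x + δ w₂ x} ¬vw₂
          (λ w₂≢x → cong₂ _+_ (δ-≢ w₂≢x) (δ-≢ w₂≢x)) two neighbour) ⟩
      sum (λ x → down G ρ x + δ x₁ x)         ≡⟨ ∑-distrib-+ (down G ρ) (δ x₁) ⟩
      sum (down G ρ) + sum (δ x₁)             ≤⟨ +-mono-≤ (sum-down≤size G ρ) (≤-reflexive (sum-δ x₁)) ⟩
      size G + 1                              ≡⟨ +-comm _ 1 ⟩
      suc (size G)                            ∎)
    where
    open ≤-Reasoning
    ρ = (v ==_) ∷ (w₁ ==_) ∷ adj G w₁ ∷ adj G v ∷ []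
    ¬w₁v = adj-sym G ¬vw₁
    ¬w₂v = adj-sym G ¬vw₂
    ¬w₂w₁ = adj-sym G ¬w₁w₂
    -- If w₂ were a leaf, then by the distance-two property its neighbour u
    -- would be adjacent to all but two vertices, hence have too large a degree.
    two-neighbours : ∃[ y ] ∃[ z ] y ≢ z × Adj G w₂ y × Adj G w₂ z
    two-neighbours = from (common-neighbour G spans v≢w₁ v≢w₂ w₁≢w₂ ¬vw₁ ¬vw₂ ¬w₁w₂)
     where
     from : ∃[ u ] Adj G v u × Adj G u w₁ × Adj G u w₂ → ∃[ y ] ∃[ z ] y ≢ z × Adj G w₂ y × Adj G w₂ z
     from (u , _ , uw₁ , uw₂) with any? (λ z → ¬? (u ≟ z) ×-dec (adj G w₂ z Bool.≟ true))
     ... | yes (z , u≢z , w₂z) = u , z , u≢z , adj-sym G uw₂ , w₂z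
     ... | no ∄z with x₂ , near₂ ← distance-two G spans w₂ = contradiction (begin-strict
       degree G v + 2                              <⟨ deg ⟩
       n                                           ≡⟨ *-identityʳ n ⟨
       n * 1                                       ≡⟨ sum-const n 1 ⟨
       sum {n} (λ _ → 1)                           ≤⟨ sum-mono (dominated x₂ near₂) ⟩
       sum (λ x → 𝟙 (adj G u x) + (δ u x + δ x₂ x))
         ≡⟨ trans (∑-distrib-+ (𝟙 ∘ adj G u) _) (cong (# (adj G u) +_) (∑-distrib-+ (δ u) (δ x₂))) ⟩
       # (adj G u) + (sum (δ u) + sum (δ x₂))
         ≡⟨ cong₂ _+_ (sym (degree≡# G u)) (cong₂ _+_ (sum-δ u) (sum-δ x₂)) ⟩
       degree G u + 2                              ≤⟨ +-monoˡ-≤ 2 (max u) ⟩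
       degree G v + 2                              ∎) (n≮n _)
       where
       unique : ∀ {z} → Adj G w₂ z → u ≡ z
       unique {z} w₂z = decidable-stable (u ≟ z) λ u≢z → ∄z (z , u≢z , w₂z)
       dominated : ∀ x₂ → (∀ {x} → x ≢ x₂ → w₂ ≢ x → adj G w₂ x ≡ false → ∃[ u ] Adj G w₂ u × Adj G u x) →
                   ∀ x → 1 ≤ 𝟙 (adj G u x) + (δ u x + δ x₂ x)
       dominated x₂ near₂ x with adj G u x in ux
       ... | true = s≤s z≤n
       ... | false with u ≟ x
       ...   | yes refl = s≤s z≤n
       ...   | no u≢x with x ≟ x₂
       ...     | yes refl = ≤-reflexive (sym (δ-refl x))
       ...     | no x≢x₂ with adj G w₂ x in w₂x
       ...       | true = contradiction (unique w₂x) u≢x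
       ...       | false with y , w₂y , yx ← near₂ x≢x₂
           (≢-sym (λ { refl → false≢true ux uw₂ })) w₂x with refl ← unique w₂y =
         ⊥-elim (false≢true ux yx)
    neighbour : ∀ {x} → Adj G v x → 2 ≤ down G ρ x + δ x₁ x
    neighbour {x} vx = except-at (one≤down G ρ xv v<x) (closer (adj G w₁ x) refl)
      where
      xv = adj-sym G vx
      v≢x = Adj⇒≢ G vx
      w₁≢x = ≢-sym (separated G vx ¬vw₁)
      v<x : Before ρ v x
      v<x = here (==-refl v) (≢⇒== v≢x)
      closer : ∀ b → adj G w₁ x ≡ b → x ≢ x₁ → 2 ≤ down G ρ x
      closer true wx _ = two≤down G ρ v≢w₁ xv v<x (adj-sym G wx)
        (there (≢⇒== v≢x) (here (==-refl w₁) (≢⇒== w₁≢x)))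
      closer false ¬wx x≢ = let u , wu , ux = near x≢ w₁≢x ¬wx in
        two≤down G ρ (≢-sym (separated G wu ¬w₁v)) xv v<x (adj-sym G ux)
          (there (≢⇒== v≢x) (there (≢⇒== w₁≢x) (here wu ¬wx)))
    v~ : ∀ {y} → Adj G w₂ y → Adj G v y
    v~ {y} w₂y with adj G v y in vy
    ... | true = refl
    ... | false with only vy
    ...   | inj₁ refl = ⊥-elim (false≢true ¬w₂v w₂y)
    ...   | inj₂ (inj₁ refl) = ⊥-elim (false≢true ¬w₂w₁ w₂y)
    ...   | inj₂ (inj₂ refl) = ⊥-elim (Adj⇒≢ G w₂y refl)
    lower : ∀ {y} → Adj G w₂ y → Before ρ y w₂
    lower w₂y = there (≢⇒== v≢w₂) (there (≢⇒== w₁≢w₂)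
      (there ¬w₁w₂ (here (v~ w₂y) ¬vw₂)))
    two : δ w₂ w₂ + δ w₂ w₂ ≤ down G ρ w₂ + δ x₁ w₂
    two = let y , z , y≢z , w₂y , w₂z = two-neighbours in
      ≤-trans (≤-reflexive (cong₂ _+_ (δ-refl w₂) (δ-refl w₂)))
        (≤-trans (two≤down G ρ y≢z w₂y (lower w₂y) w₂z (lower w₂z)) (m≤m+n _ _))

  2degree+1≤size : ∀ {v} → degree G v + 3 ≡ n → (∀ u → degree G u ≤ degree G v) →
                   degree G v + degree G v + 1 ≤ size G
  2degree+1≤size {v} deg max
    with w₁ , ¬vw₁ , v≢w₁ ∷ [] ← ∃-nonneighbour G v (v ∷ []) (room (≤-reflexive deg) (s≤s (s≤s z≤n)))
    with w₂ , ¬vw₂ , v≢w₂ ∷ w₁≢w₂ ∷ [] ← ∃-nonneighbour G v (v ∷ w₁ ∷ []) (room (≤-reflexive deg) ≤-refl)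
    = bound (adj G w₁ w₂) refl
    where
    only : ∀ {x} → adj G v x ≡ false → x ≡ v ⊎ x ≡ w₁ ⊎ x ≡ w₂
    only {x} ¬vx with x ≟ v | x ≟ w₁ | x ≟ w₂
    ... | yes x≡v | _ | _ = inj₁ x≡v
    ... | no _ | yes x≡w₁ | _ = inj₂ (inj₁ x≡w₁)
    ... | no _ | no _ | yes x≡w₂ = inj₂ (inj₂ x≡w₂)
    ... | no x≢v | no x≢w₁ | no x≢w₂ = contradiction
      (≤-trans (s≤s (≤-reflexive (sym deg))) (≤-trans (≤-reflexive (sym (+-suc _ 3)))
        (degree+nonneighbours≤n G {v} ((x≢v ∷ x≢w₁ ∷ x≢w₂ ∷ []) ∷ triple! v≢w₁ v≢w₂ w₁≢w₂)
            (¬vx ∷ Graph.irrefl G v ∷ ¬vw₁ ∷ ¬vw₂ ∷ []))))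
      (n≮n n)
    bound : ∀ b → adj G w₁ w₂ ≡ b → degree G v + degree G v + 1 ≤ size G
    bound true  w₁w₂ = 2degree+1≤size-adjacent v≢w₁ v≢w₂ ¬vw₁ ¬vw₂ w₁w₂
    bound false ¬w₁w₂ = 2degree+1≤size-nonadjacent only v≢w₁ v≢w₂ w₁≢w₂ ¬vw₁ ¬vw₂ ¬w₁w₂
        (room (≤-reflexive deg) ≤-refl) max

module _ (G : Graph n) {v : Fin n} where

  -- Parents alone account for one edge at each vertex but the root `v`, that is n - 1. The second
  -- earlier neighbour of `t` closes a cycle and supplies the last edge.
  n≤size-rank : ∀ cs {t y z} → (∀ {x} → v ≢ x → ∃[ u ] Adj G x u × Before cs u x) →
                y ≢ z → Adj G t y → Before cs y t → Adj G t z → Before cs z t → n ≤ size G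
  n≤size-rank cs {t} {y} {z} parent y≢z ty y<t tz z<t = +-cancelʳ-≤ 1 n (size G) (begin
    n + 1                                    ≡⟨ cong₂ _+_ (trans (sum-const n 1) (*-identityʳ n)) (sum-δ t) ⟨
    sum {n} (λ _ → 1) + sum (δ t)            ≡⟨ ∑-distrib-+ {n} (λ _ → 1) (δ t) ⟨
    sum (λ x → 1 + δ t x)                    ≤⟨ sum-mono pointwise ⟩
    sum (λ x → down G cs x + δ v x)          ≡⟨ ∑-distrib-+ (down G cs) (δ v) ⟩
    sum (down G cs) + sum (δ v)              ≤⟨ +-mono-≤ (sum-down≤size G cs) (≤-reflexive (sum-δ v)) ⟩
    size G + 1                               ∎)
    where
    open ≤-Reasoning
    two : 1 + δ t t ≤ down G cs t + δ v t
    two = ≤-trans (≤-reflexive (cong suc (δ-refl t))) (≤-trans (two≤down G cs y≢z ty y<t tz z<t) (m≤m+n _ _))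
    one : ∀ {x} → t ≢ x → Dec (x ≡ v) → 1 + δ t x ≤ down G cs x + δ v x
    one {x} t≢x (yes refl) = ≤-trans (≤-reflexive (trans (cong suc (δ-≢ t≢x)) (sym (δ-refl x)))) (m≤n+m _ _)
    one {x} t≢x (no x≢v) = let u , xu , u<x = parent (≢-sym x≢v) in
      ≤-trans (≤-reflexive (cong suc (δ-≢ t≢x))) (≤-trans (one≤down G cs xu u<x) (m≤m+n _ _))
    pointwise : ∀ x → 1 + δ t x ≤ down G cs x + δ v x
    pointwise x = at (t ≟ x)
      where
      at : Dec (t ≡ x) → 1 + δ t x ≤ down G cs x + δ v x
      at (yes refl) = two
      at (no t≢x)   = one t≢x (x ≟ v)

  -- `t` is put alone in the last place, so all its neighbours precede it. One of them is its
  -- parent, so `t` itself may be far from `v`.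
  n≤size-outer : ∀ {t y z} → v ≢ t → adj G v t ≡ false → y ≢ z → Adj G t y → Adj G t z →
                 (∀ {x} → v ≢ x → adj G v x ≡ false → t ≢ x → ∃[ u ] Adj G v u × Adj G u x) → n ≤ size G
  n≤size-outer {t} {y} {z} v≢t ¬vt y≢z ty tz hub =
    n≤size-rank cs (λ v≢x → parent v≢x (adj G v _) refl (t ≟ _)) y≢z ty (top ty) tz (top tz)
    where
    cs = (v ==_) ∷ adj G v ∷ (not ∘ (t ==_)) ∷ []
    top : ∀ {y} → Adj G t y → Before cs y t
    top ty = there (≢⇒== v≢t) (there ¬vt (here (cong not (≢⇒== (Adj⇒≢ G ty))) (cong not (==-refl t))))
    parent : ∀ {x} → v ≢ x → ∀ b → adj G v x ≡ b → Dec (t ≡ x) → ∃[ u ] Adj G x u × Before cs u x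
    parent v≢x true  vx _ = v , adj-sym G vx , here (==-refl v) (≢⇒== v≢x)
    parent v≢x false ¬vx (yes refl) = y , ty , top ty
    parent v≢x false ¬vx (no t≢x) = let u , vu , ux = hub v≢x ¬vx t≢x in
      u , adj-sym G ux , there (≢⇒== v≢x) (here vu ¬vx)

  -- Among the neighbours of `v`, `t` is moved behind the others, so that both other corners of the
  -- triangle `v`, `t`, `y` precede it.
  n≤size-inner : ∀ {t y} → Adj G v t → Adj G v y → Adj G t y →
                 (∀ {x} → v ≢ x → adj G v x ≡ false → ∃[ u ] Adj G v u × Adj G u x) → n ≤ size G
  n≤size-inner {t} {y} vt vy ty hub =
    n≤size-rank cs (λ v≢x → parent v≢x (adj G v _) refl) (Adj⇒≢ G vy)
      (adj-sym G vt) (here (==-refl v) (≢⇒== (Adj⇒≢ G vt)))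
      ty (there (≢⇒== (Adj⇒≢ G vt)) (here (∧-true⁺ vy (cong not (≢⇒== (Adj⇒≢ G ty))))
          (trans (cong (λ b → adj G v t ∧ not b) (==-refl t)) (∧-zeroʳ _))))
    where
    cs = (v ==_) ∷ (λ x → adj G v x ∧ not (t == x)) ∷ adj G v ∷ []
    parent : ∀ {x} → v ≢ x → ∀ b → adj G v x ≡ b → ∃[ u ] Adj G x u × Before cs u x
    parent v≢x true  vx = v , adj-sym G vx , here (==-refl v) (≢⇒== v≢x)
    parent {x} v≢x false ¬vx = let u , vu , ux = hub v≢x ¬vx in
      u , adj-sym G ux , there (≢⇒== v≢x) (there (cong (_∧ not (t == x)) ¬vx) (here vu ¬vx))

module _ (G : Graph n) (spans : TriplesSpan G 3) where

  -- If some `t` has no common neighbour with `v`, branching makes it adjacent to every other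
  -- non-neighbour of `v`, of which there are at least two. Otherwise let `z` join `w` to `v`, and
  -- let `x`, `y` be two further neighbours of `v`. Reaching `x` or `y` from `w` gives a second
  -- neighbour of `w`, an edge between two neighbours of `v`, or a non-neighbour `u` of `v` with two
  -- neighbours.
  n≤size : ∀ {v} → degree G v + 4 ≤ n → 3 ≤ degree G v → n ≤ size G
  n≤size {v} few many = split (any? λ x → ¬? (v ≟ x) ×-dec ((adj G v x Bool.≟ false) ×-dec ¬? (near? G v x)))
    where
    far : ∀ {t} → v ≢ t → adj G v t ≡ false → ¬ (∃[ u ] Adj G v u × Adj G u t) → n ≤ size G
    far {t} v≢t ¬vt ¬near
      with x , ¬vx , v≢x ∷ t≢x ∷ [] ← ∃-nonneighbour G v (v ∷ t ∷ []) (room few (s≤s (s≤s (s≤s z≤n))))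
      with y , ¬vy , v≢y ∷ t≢y ∷ x≢y ∷ [] ← ∃-nonneighbour G v (v ∷ t ∷ x ∷ []) (room few ≤-refl) =
      n≤size-outer G v≢t ¬vt x≢y (proj₂ (proj₂ (proj₂ (hub v≢x ¬vx t≢x))))
          (proj₂ (proj₂ (proj₂ (hub v≢y ¬vy t≢y))))
        (λ v≢x ¬vx t≢x → let u , vu , ux , _ = hub v≢x ¬vx t≢x in u , vu , ux)
      where
      hub : ∀ {x} → v ≢ x → adj G v x ≡ false → t ≢ x → ∃[ u ] Adj G v u × Adj G u x × Adj G t x
      hub {x} v≢x ¬vx t≢x = from (branching G spans v≢t v≢x t≢x ¬vt ¬vx)
        where
        from : ∃[ u ] Adj G v u × (Adj G u t × (Adj G u x ⊎ Adj G t x) ⊎ Adj G u x × (Adj G u t ⊎ Adj G t x)) →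
               ∃[ u ] Adj G v u × Adj G u x × Adj G t x
        from (u , vu , inj₁ (ut , _))       = contradiction (u , vu , ut) ¬near
        from (u , vu , inj₂ (ux , inj₁ ut)) = contradiction (u , vu , ut) ¬near
        from (u , vu , inj₂ (ux , inj₂ tx)) = u , vu , ux , tx
    all-near : (∀ {x} → v ≢ x → adj G v x ≡ false → ∃[ u ] Adj G v u × Adj G u x) → n ≤ size G
    all-near hub
      with w , ¬vw , v≢w ∷ [] ← ∃-nonneighbour G v (v ∷ []) (room few (s≤s (s≤s z≤n)))
      with z , vz , zw ← hub v≢w ¬vw
      with x , vx , z≢x ∷ [] ← ∃-neighbour G v (z ∷ []) (≤-trans (s≤s (s≤s z≤n)) many)
      with y , vy , z≢y ∷ x≢y ∷ [] ← ∃-neighbour G v (z ∷ x ∷ []) many =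
      cases (adj G w x) (adj G w y) refl refl
      where
      outer : ∀ {t y z} → v ≢ t → adj G v t ≡ false → y ≢ z → Adj G t y → Adj G t z → n ≤ size G
      outer v≢t ¬vt y≢z ty tz = n≤size-outer G v≢t ¬vt y≢z ty tz λ v≢x ¬vx _ → hub v≢x ¬vx
      w≢ : ∀ {x} → Adj G v x → w ≢ x
      w≢ vx = ≢-sym (separated G vx ¬vw)
      via : ∀ {u x} → Adj G v x → Adj G w u → Adj G u x → ∀ b → adj G v u ≡ b → n ≤ size G
      via vx wu ux true  vu = n≤size-inner G vu vx ux hub
      via vx wu ux false ¬vu = outer (≢-sym (separated G wu (adj-sym G ¬vw))) ¬vu (w≢ vx) (adj-sym G wu) ux
      from : ∃[ u ] Adj G w u × (Adj G u x ⊎ Adj G u y) → n ≤ size G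
      from (u , wu , inj₁ ux) = via vx wu ux (adj G v u) refl
      from (u , wu , inj₂ uy) = via vy wu uy (adj G v u) refl
      cases : ∀ b c → adj G w x ≡ b → adj G w y ≡ c → n ≤ size G
      cases true  _     wx _  = outer v≢w ¬vw z≢x (adj-sym G zw) wx
      cases false true  _  wy = outer v≢w ¬vw z≢y (adj-sym G zw) wy
      cases false false ¬wx ¬wy = from (branching-near G spans (w≢ vx) (w≢ vy) x≢y ¬wx ¬wy)
    split : Dec (∃[ x ] v ≢ x × adj G v x ≡ false × ¬ (∃[ u ] Adj G v u × Adj G u x)) → n ≤ size G
    split (yes (t , v≢t , ¬vt , ¬near)) = far v≢t ¬vt ¬near
    split (no ∄t) = all-near λ {x} v≢x ¬vx → decidable-stable (near? G v x) λ ¬near → ∄t (x , v≢x , ¬vx , ¬near)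

  -- A neighbour of `v` cannot also be adjacent to two non-neighbours of `v`, so any two
  -- non-neighbours are adjacent. Three of them form a triangle, and some corner has a third
  -- neighbour `u` next to `v`.
  ¬maxDegree-2 : ∀ {v} → degree G v + 4 ≤ n → (∀ u → degree G u ≤ 2) → ⊥
  ¬maxDegree-2 {v} few max
    with x , ¬vx , v≢x ∷ [] ← ∃-nonneighbour G v (v ∷ []) (room few (s≤s (s≤s z≤n)))
    with y , ¬vy , v≢y ∷ x≢y ∷ [] ← ∃-nonneighbour G v (v ∷ x ∷ []) (room few (s≤s (s≤s (s≤s z≤n))))
    with z , ¬vz , v≢z ∷ x≢z ∷ y≢z ∷ [] ← ∃-nonneighbour G v (v ∷ x ∷ y ∷ []) (room few ≤-refl) =
    crowded (joined v≢x v≢y x≢y ¬vx ¬vy)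
    where
    no-three : ∀ {u a b c} → a ≢ b → a ≢ c → b ≢ c → Adj G u a → Adj G u b → Adj G u c → ⊥
    no-three {u} a≢b a≢c b≢c ua ub uc =
      n≮n 2 (≤-trans (length≤degree G (triple! a≢b a≢c b≢c) (ua ∷ ub ∷ uc ∷ [])) (max u))
    joined : ∀ {a b} → v ≢ a → v ≢ b → a ≢ b → adj G v a ≡ false → adj G v b ≡ false →
             Adj G a b × ∃[ u ] Adj G v u × (Adj G u a ⊎ Adj G u b)
    joined {a} {b} v≢a v≢b a≢b ¬va ¬vb = from (branching G spans v≢a v≢b a≢b ¬va ¬vb)
      where
      from : ∃[ u ] Adj G v u × (Adj G u a × (Adj G u b ⊎ Adj G a b) ⊎ Adj G u b × (Adj G u a ⊎ Adj G a b)) →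
             Adj G a b × ∃[ u ] Adj G v u × (Adj G u a ⊎ Adj G u b)
      from (u , vu , inj₁ (ua , inj₁ ub)) = ⊥-elim (no-three v≢a v≢b a≢b (adj-sym G vu) ua ub)
      from (u , vu , inj₂ (ub , inj₁ ua)) = ⊥-elim (no-three v≢a v≢b a≢b (adj-sym G vu) ua ub)
      from (u , vu , inj₁ (ua , inj₂ ab)) = ab , u , vu , inj₁ ua
      from (u , vu , inj₂ (ub , inj₂ ab)) = ab , u , vu , inj₂ ub
    crowded : Adj G x y × ∃[ u ] Adj G v u × (Adj G u x ⊎ Adj G u y) → ⊥
    crowded (xy , u , vu , inj₁ ux) = no-three (separated G vu ¬vy) (separated G vu ¬vz) y≢z
      (adj-sym G ux) xy (proj₁ (joined v≢x v≢z x≢z ¬vx ¬vz))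
    crowded (xy , u , vu , inj₂ uy) = no-three (separated G vu ¬vx) (separated G vu ¬vz) x≢z
      (adj-sym G uy) (adj-sym G xy) (proj₁ (joined v≢y v≢z y≢z ¬vy ¬vz))

-- Extremal graphs

∃-triple : ∃[ S ] ∣_∣ {suc (suc (suc n))} S ≡ 3
∃-triple = let S , e , _ = triple {a = 0F} {1F} {2F} (λ ()) (λ ()) (λ ()) in S , e

ℋ₃⁺ : ∀ {G : Graph n} {ℓ d} → 3 ≤ n → MaxDegree G ℓ → TriplesSpan G d → ℋ₃ n ℓ d G
ℋ₃⁺ (s≤s (s≤s (s≤s z≤n))) max spans = record
  { maxDegree = max
  ; sdiam≤d   = triplesSpan⇒sdiam≤ ∃-triple spans
  }

ℋ₃⁻ : ∀ {G : Graph n} {ℓ d} → ℋ₃ n ℓ d G → MaxDegree G ℓ × TriplesSpan G d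
ℋ₃⁻ h = ℋ₃.maxDegree h , sdiam≤⇒triplesSpan (ℋ₃.sdiam≤d h)

∣∣≡# : (S : Subset n) → ∣ S ∣ ≡ # (lookup S)
∣∣≡# S = trans (cong ∣_∣ (sym (tabulate∘lookup S))) (∣tabulate∣ (lookup S))

length≤∣∣ : ∀ (S : Subset n) {xs} → Unique xs → All (_∈ S) xs → length xs ≤ ∣ S ∣
length≤∣∣ S xs! xs∈S rewrite ∣∣≡# S = length≤# xs! (All.map []=⇒lookup xs∈S)

∃-outside : ∀ (S : Subset n) xs → length xs < ∣ S ∣ → ∃[ x ] x ∈ S × All (_≢ x) xs
∃-outside S xs l = let x , e , outside = #⇒∃-outside (lookup S) xs (≤-trans l (≤-reflexive (∣∣≡# S))) in
  x , lookup⇒[]= x S e , outside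

module _ (G : Graph n) where

  Near : Fin n → Fin n → Set
  Near u v = u ≡ v ⊎ Adj G u v

  -- Quantifying over all sets inside the triple makes the property visibly symmetric and allows
  -- repetitions.
  Joined : Fin n → Fin n → Fin n → Set
  Joined a b c = ∀ S → (∀ {s} → s ∈ S → s ≡ a ⊎ s ≡ b ⊎ s ≡ c) → Spans G S 3

  joined-swap₁₂ : ∀ {a b c} → Joined a b c → Joined b a c
  joined-swap₁₂ j S S⊆ = j S ([ inj₂ ∘ inj₁ , [ inj₁ , inj₂ ∘ inj₂ ]′ ]′ ∘ S⊆)

  joined-swap₂₃ : ∀ {a b c} → Joined a b c → Joined a c b
  joined-swap₂₃ j S S⊆ = j S ([ inj₁ , inj₂ ∘ swap ]′ ∘ S⊆)

  grow-near : ∀ {S k X p q} → p ∈ X → Near p q → Grows G S k (X ∪ ⁅ q ⁆) → Grows G S (suc k) X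
  grow-near p∈X (inj₂ pq) g = inj₂ (_ , _ , p∈X , pq , g)
  grow-near {S} {X = X} p∈X (inj₁ refl) g = inj₁ (grows-⊆ G S (λ {v} v∈ → absorb (∈-∪⁅⁆⁻ X v∈)) g)
    where
    absorb : ∀ {v} → v ∈ X ⊎ v ≡ _ → v ∈ X
    absorb (inj₁ v∈X)  = v∈X
    absorb (inj₂ refl) = p∈X

  -- The one tree shape behind `star`, `bridge` and `bridge-root`. As `Near` admits equality, trees
  -- with fewer edges are instances.
  spider : ∀ {S r x y z} → Near r x → Near r y → Near r z ⊎ Adj G x z →
           (∀ {s} → s ∈ S → s ≡ r ⊎ s ≡ x ⊎ s ≡ y ⊎ s ≡ z) → Spans G S 3
  spider {S} {r} {x} {y} {z} rx ry z-end S⊆ =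
    r , grow-near (x∈⁅x⁆ r) rx (grow-near (p⊆p∪q _ (x∈⁅x⁆ r)) ry (leg z-end))
    where
    X = (⁅ r ⁆ ∪ ⁅ x ⁆) ∪ ⁅ y ⁆
    covers : ∀ {s} → s ≡ r ⊎ s ≡ x ⊎ s ≡ y ⊎ s ≡ z → s ∈ X ∪ ⁅ z ⁆
    covers (inj₁ refl)                      = p⊆p∪q _ (p⊆p∪q _ (p⊆p∪q _ (x∈⁅x⁆ r)))
    covers (inj₂ (inj₁ refl))               = p⊆p∪q _ (p⊆p∪q _ (q⊆p∪q _ _ (x∈⁅x⁆ x)))
    covers (inj₂ (inj₂ (inj₁ refl)))        = p⊆p∪q _ (q⊆p∪q _ _ (x∈⁅x⁆ y))
    covers (inj₂ (inj₂ (inj₂ refl)))        = q⊆p∪q _ _ (x∈⁅x⁆ z)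
    leg : Near r z ⊎ Adj G x z → Grows G S 1 X
    leg (inj₁ rz) = grow-near {k = 0} (p⊆p∪q _ (p⊆p∪q _ (x∈⁅x⁆ r))) rz (covers ∘ S⊆)
    leg (inj₂ xz) = grow-near {k = 0} (p⊆p∪q _ (q⊆p∪q _ _ (x∈⁅x⁆ x))) (inj₂ xz) (covers ∘ S⊆)

  star : ∀ {r a b c} → Near r a → Near r b → Near r c → Joined a b c
  star ra rb rc S S⊆ = spider ra rb (inj₁ rc) (inj₂ ∘ S⊆)

  bridge : ∀ {r x y z} → Near r x → Near r y → Adj G x z → Joined z x y
  bridge rx ry xz S S⊆ =
    spider rx ry (inj₂ xz) (inj₂ ∘ [ inj₂ ∘ inj₂ , [ inj₁ , inj₂ ∘ inj₁ ]′ ]′ ∘ S⊆)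

  -- The path z ─ x ─ r ─ y of `bridge`, with `r` as a target and `x` as an auxiliary vertex.
  bridge-root : ∀ {r x y z} → Near r x → Near r y → Adj G x z → Joined z r y
  bridge-root rx ry xz S S⊆ =
    spider rx ry (inj₂ xz) ([ inj₂ ∘ inj₂ ∘ inj₂ , [ inj₁ , inj₂ ∘ inj₂ ∘ inj₁ ]′ ]′ ∘ S⊆)

  joined⇒triplesSpan : (∀ {a b c} → a ≢ b → a ≢ c → b ≢ c → Joined a b c) → TriplesSpan G 3
  joined⇒triplesSpan joined S ∣S∣≡3
    with a , pa , [] ← ∃-outside S [] (≤-trans (s≤s z≤n) (≤-reflexive (sym ∣S∣≡3)))
    with b , pb , a≢b ∷ [] ← ∃-outside S (a ∷ []) (≤-trans (s≤s (s≤s z≤n)) (≤-reflexive (sym ∣S∣≡3)))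
    with c , pc , a≢c ∷ b≢c ∷ [] ← ∃-outside S (a ∷ b ∷ []) (≤-reflexive (sym ∣S∣≡3)) =
    joined a≢b a≢c b≢c S covered
    where
    covered : ∀ {s} → s ∈ S → s ≡ a ⊎ s ≡ b ⊎ s ≡ c
    covered {s} s∈S with s ≟ a | s ≟ b | s ≟ c
    ... | yes s≡a | _ | _ = inj₁ s≡a
    ... | no _ | yes s≡b | _ = inj₂ (inj₁ s≡b)
    ... | no _ | no _ | yes s≡c = inj₂ (inj₂ s≡c)
    ... | no s≢a | no s≢b | no s≢c = contradiction
      (length≤∣∣ S ((s≢a ∷ s≢b ∷ s≢c ∷ []) ∷ triple! a≢b a≢c b≢c) (s∈S ∷ pa ∷ pb ∷ pc ∷ []))
      (λ l → n≮n 3 (≤-trans l (≤-reflexive ∣S∣≡3)))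

module _ {K : Set} (R : K → K → Bool) (R-irrefl : ∀ k → R k k ≡ false) (κ : Fin n → K) where

  -- Replacing the vertices k of an oriented graph by the independent sets κ⁻¹(k).
  blowUp : Graph n
  blowUp = record
    { adj    = λ u v → R (κ u) (κ v) ∨ R (κ v) (κ u)
    ; sym    = λ u v → ∨-comm (R (κ u) (κ v)) (R (κ v) (κ u))
    ; irrefl = λ v → cong₂ _∨_ (R-irrefl (κ v)) (R-irrefl (κ v))
    }

  size-blowUp : size blowUp ≤ ## (λ u v → R (κ u) (κ v))
  size-blowUp = size≤orientation blowUp λ {u} → ∨-true⁻ {R (κ u) _}

IsMin-e₃ : ∀ {ℓ d b} (G : Graph n) → ℋ₃ n ℓ d G → size G ≤ b →
           (∀ H → ℋ₃ n ℓ d H → b ≤ size H) → e₃[ n , ℓ , d ]≔ [ b ]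
IsMin-e₃ G h ≤b b≤ = (G , h , ≤-antisym ≤b (b≤ G h)) , λ { j (H , hH , refl) → b≤ H hH }

-- Identifies the vertices j, j + 1, … with each other.
collapse : ∀ j {m} → Fin (j + m) → Fin (suc j)
collapse zero    _       = zero
collapse (suc j) zero    = zero
collapse (suc j) (suc i) = suc (collapse j i)

-- A sum over the vertices taken class by class, the last class having `m` members; degrees and
-- sizes become expressions in `m`.
weigh : ∀ j → ℕ → (Fin (suc j) → ℕ) → ℕ
weigh zero    m f = m * f zero
weigh (suc j) m f = f zero + weigh j m (f ∘ suc)

sum-collapse : ∀ j {m} (f : Fin (suc j) → ℕ) → sum (f ∘ collapse j {m}) ≡ weigh j m f
sum-collapse zero    {m} f = sum-const m (f zero)
sum-collapse (suc j) {m} f = cong (f zero +_) (sum-collapse j (f ∘ suc))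

module CollapsedBlowUp {j} (R : Fin (suc j) → Fin (suc j) → Bool) (R-irrefl : ∀ k → R k k ≡ false) (m : ℕ) where

  graph : Graph (j + m)
  graph = blowUp R R-irrefl (collapse j)

  degreeOf : Fin (suc j) → ℕ
  degreeOf k = weigh j m (λ l → 𝟙 (R k l ∨ R l k))

  degree≡ : ∀ u → degree graph u ≡ degreeOf (collapse j u)
  degree≡ u = trans (degree≡# graph u) (sum-collapse j _)

  maxDegree : ∀ {ℓ} u → degreeOf (collapse j u) ≡ ℓ → (∀ k → degreeOf k ≤ ℓ) → MaxDegree graph ℓ
  maxDegree u e ≤ℓ = (u , trans (degree≡ u) e) , λ v → ≤-trans (≤-reflexive (degree≡ v)) (≤ℓ _)

  size≤ : size graph ≤ weigh j m (λ k → weigh j m (λ l → 𝟙 (R k l)))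
  size≤ = ≤-trans (size-blowUp R R-irrefl (collapse j))
    (≤-reflexive (trans (sum-cong-≗ (λ u → sum-collapse j (𝟙 ∘ R (collapse j u)))) (sum-collapse j {m} _)))

module StarGraph where

  R : Fin 2 → Fin 2 → Bool
  R 1F 0F = true
  R _  _  = false

  irrefl : ∀ k → R k k ≡ false
  irrefl 0F = refl
  irrefl 1F = refl

  module _ (m : ℕ) where
    open CollapsedBlowUp {1} R irrefl m public

    centre : ∀ x → Near graph 0F x
    centre zero    = inj₁ refl
    centre (suc _) = inj₂ refl

    member : 2 ≤ m → ℋ₃ (suc m) m 3 graph
    member 2≤m = ℋ₃⁺ (s≤s 2≤m) (maxDegree 0F (*-identityʳ m) bound)
      (joined⇒triplesSpan graph λ {a} {b} {c} _ _ _ → star graph (centre a) (centre b) (centre c))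
      where
      bound : ∀ k → degreeOf k ≤ m
      bound 0F = ≤-reflexive (*-identityʳ m)
      bound 1F rewrite *-zeroʳ m = ≤-trans (n≤1+n 1) 2≤m

    size≤m : size graph ≤ m
    size≤m = ≤-trans size≤ (≤-reflexive weight)
      where
      weight : weigh 1 m (λ k → weigh 1 m (λ l → 𝟙 (R k l))) ≡ m
      weight rewrite *-zeroʳ m = *-identityʳ m

-- K_{2,m} with parts {0, 1} and {3, 4, …}, together with the edge 0 ─ 2.
module OneFar where

  R : Fin 4 → Fin 4 → Bool
  R 2F 0F = true
  R 3F 0F = true
  R 3F 1F = true
  R _  _  = false

  irrefl : ∀ k → R k k ≡ false
  irrefl 0F = refl
  irrefl 1F = refl
  irrefl 2F = refl
  irrefl 3F = refl

  module _ (m : ℕ) where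
    open CollapsedBlowUp {3} R irrefl (suc m) public

    near-0 : ∀ {x} → x ≢ 1F → Near graph 0F x
    near-0 {0F} _ = inj₁ refl
    near-0 {1F} 1≢1 = contradiction refl 1≢1
    near-0 {2F} _ = inj₂ refl
    near-0 {suc (suc (suc _))} _ = inj₂ refl

    joined-1 : ∀ b c → b ≢ 1F → c ≢ 1F → b ≢ c → Joined graph 1F b c
    joined-1 1F _ 1≢1 _ _ = contradiction refl 1≢1
    joined-1 _ 1F _ 1≢1 _ = contradiction refl 1≢1
    -- A vertex of the large class is adjacent to both 0 and 1, hence links 1 to the closed
    -- neighbourhood of 0.
    joined-1 (suc (suc (suc _))) c _ c≢1 _ = bridge graph (inj₂ refl) (near-0 c≢1) refl
    joined-1 b (suc (suc (suc _))) b≢1 _ _ = joined-swap₂₃ graph (bridge graph (inj₂ refl) (near-0 b≢1) refl)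
    joined-1 0F 0F _ _ 0≢0 = contradiction refl 0≢0
    joined-1 2F 2F _ _ 2≢2 = contradiction refl 2≢2
    -- The large class has `suc m` members, so vertex 3 is available as a link.
    joined-1 0F 2F _ _ _ = bridge-root graph {x = 3F} (inj₂ refl) (inj₂ refl) refl
    joined-1 2F 0F _ _ _ = joined-swap₂₃ graph (bridge-root graph {x = 3F} (inj₂ refl) (inj₂ refl) refl)

    joined : ∀ {a b c} → a ≢ b → a ≢ c → b ≢ c → Joined graph a b c
    joined {a} {b} {c} a≢b a≢c b≢c with a ≟ 1F | b ≟ 1F | c ≟ 1F
    ... | yes refl | _ | _ = joined-1 b c (≢-sym a≢b) (≢-sym a≢c) b≢c
    ... | no _ | yes refl | _ = joined-swap₁₂ graph (joined-1 a c a≢b (≢-sym b≢c) a≢c)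
    ... | no _ | no _ | yes refl = joined-swap₂₃ graph (joined-swap₁₂ graph (joined-1 a b a≢c b≢c a≢b))
    ... | no a≢1 | no b≢1 | no c≢1 = star graph (near-0 a≢1) (near-0 b≢1) (near-0 c≢1)

    member : ℋ₃ (4 + m) (2 + m) 3 graph
    member = ℋ₃⁺ (s≤s (s≤s (s≤s z≤n))) (maxDegree 0F full bound) (joined⇒triplesSpan graph joined)
      where
      full : degreeOf 0F ≡ 2 + m
      full = cong suc (*-identityʳ (suc m))
      bound : ∀ k → degreeOf k ≤ 2 + m
      bound 0F = ≤-reflexive full
      bound 1F = ≤-trans (≤-reflexive (*-identityʳ (suc m))) (n≤1+n _)
      bound 2F rewrite *-zeroʳ m = s≤s z≤n
      bound 3F rewrite *-zeroʳ m = s≤s (s≤s z≤n)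

    size≤2n∸5 : size graph ≤ 2 * (4 + m) ∸ 5
    size≤2n∸5 = ≤-trans size≤ (≤-reflexive (trans weight (sym (trans (cong (_∸ 5) (double m)) (m+n∸m≡n 5 _)))))
      where
      double : ∀ m → 2 * (4 + m) ≡ 5 + (1 + suc m * 2)
      double = solve-∀
      weight : weigh 3 (suc m) (λ k → weigh 3 (suc m) (λ l → 𝟙 (R k l))) ≡ 1 + suc m * 2
      weight rewrite *-zeroʳ m = refl

-- K_{2,m} with parts {0, 1} and {4, 5, …}, together with the path 0 ─ 3 ─ 2 ─ 1.
module TwoFar where

  R : Fin 5 → Fin 5 → Bool
  R 2F 1F = true
  R 3F 0F = true
  R 3F 2F = true
  R 4F 0F = true
  R 4F 1F = true
  R _  _  = false

  irrefl : ∀ k → R k k ≡ false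
  irrefl 0F = refl
  irrefl 1F = refl
  irrefl 2F = refl
  irrefl 3F = refl
  irrefl 4F = refl

  module _ (m : ℕ) where
    open CollapsedBlowUp {4} R irrefl (suc m) public

    near-0 : ∀ {x} → x ≢ 1F → x ≢ 2F → Near graph 0F x
    near-0 {0F} _ _ = inj₁ refl
    near-0 {1F} 1≢1 _ = contradiction refl 1≢1
    near-0 {2F} _ 2≢2 = contradiction refl 2≢2
    near-0 {3F} _ _ = inj₂ refl
    near-0 {suc (suc (suc (suc _)))} _ _ = inj₂ refl

    -- 1 and 2 are the only vertices outside the closed neighbourhood of 0, so triples are sorted by
    -- which of the two they contain.
    joined-12 : ∀ c → Joined graph 1F 2F c
    joined-12 0F = joined-swap₂₃ graph (joined-swap₁₂ graph
      (joined-swap₂₃ graph (bridge-root graph {x = 3F} (inj₂ refl) (inj₂ refl) refl)))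
    joined-12 1F = star graph {r = 1F} (inj₁ refl) (inj₂ refl) (inj₁ refl)
    joined-12 2F = star graph {r = 2F} (inj₂ refl) (inj₁ refl) (inj₁ refl)
    joined-12 3F = star graph {r = 2F} (inj₂ refl) (inj₁ refl) (inj₂ refl)
    joined-12 (suc (suc (suc (suc _)))) = star graph {r = 1F} (inj₁ refl) (inj₂ refl) (inj₂ refl)

    joined-1 : ∀ b c → b ≢ 1F → c ≢ 1F → b ≢ 2F → c ≢ 2F → b ≢ c → Joined graph 1F b c
    joined-1 1F _ 1≢1 _ _ _ _ = contradiction refl 1≢1
    joined-1 _ 1F _ 1≢1 _ _ _ = contradiction refl 1≢1
    joined-1 2F _ _ _ 2≢2 _ _ = contradiction refl 2≢2
    joined-1 _ 2F _ _ _ 2≢2 _ = contradiction refl 2≢2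
    joined-1 (suc (suc (suc (suc _)))) c _ c≢1 _ c≢2 _ = bridge graph (inj₂ refl) (near-0 c≢1 c≢2) refl
    joined-1 b (suc (suc (suc (suc _)))) b≢1 _ b≢2 _ _ = joined-swap₂₃ graph
        (bridge graph (inj₂ refl) (near-0 b≢1 b≢2) refl)
    joined-1 0F 0F _ _ _ _ 0≢0 = contradiction refl 0≢0
    joined-1 3F 3F _ _ _ _ 3≢3 = contradiction refl 3≢3
    joined-1 0F 3F _ _ _ _ _ = bridge-root graph {x = 4F} (inj₂ refl) (inj₂ refl) refl
    joined-1 3F 0F _ _ _ _ _ = joined-swap₂₃ graph (bridge-root graph {x = 4F} (inj₂ refl) (inj₂ refl) refl)

    joined-2 : ∀ b c → b ≢ 1F → c ≢ 1F → b ≢ 2F → c ≢ 2F → b ≢ c → Joined graph 2F b c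
    joined-2 1F _ 1≢1 _ _ _ _ = contradiction refl 1≢1
    joined-2 _ 1F _ 1≢1 _ _ _ = contradiction refl 1≢1
    joined-2 2F _ _ _ 2≢2 _ _ = contradiction refl 2≢2
    joined-2 _ 2F _ _ _ 2≢2 _ = contradiction refl 2≢2
    -- Vertex 3 does for 2 what the large class does for 1: it is adjacent to 0 and to 2.
    joined-2 3F c _ c≢1 _ c≢2 _ = bridge graph (inj₂ refl) (near-0 c≢1 c≢2) refl
    joined-2 b 3F b≢1 _ b≢2 _ _ = joined-swap₂₃ graph (bridge graph (inj₂ refl) (near-0 b≢1 b≢2) refl)
    joined-2 0F 0F _ _ _ _ 0≢0 = contradiction refl 0≢0
    joined-2 0F (suc (suc (suc (suc _)))) _ _ _ _ _ = bridge-root graph {x = 3F} (inj₂ refl) (inj₂ refl) refl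
    joined-2 (suc (suc (suc (suc _)))) 0F _ _ _ _ _ =
      joined-swap₂₃ graph (bridge-root graph {x = 3F} (inj₂ refl) (inj₂ refl) refl)
    joined-2 (suc (suc (suc (suc _)))) (suc (suc (suc (suc _)))) _ _ _ _ _ =
      star graph {r = 1F} (inj₂ refl) (inj₂ refl) (inj₂ refl)

    with-1 : ∀ {b c} → b ≢ 1F → c ≢ 1F → b ≢ c → Joined graph 1F b c
    with-1 {b} {c} b≢1 c≢1 b≢c with b ≟ 2F | c ≟ 2F
    ... | yes refl | _ = joined-12 c
    ... | no _ | yes refl = joined-swap₂₃ graph (joined-12 b)
    ... | no b≢2 | no c≢2 = joined-1 b c b≢1 c≢1 b≢2 c≢2 b≢c

    without-1 : ∀ {a b c} → a ≢ 1F → b ≢ 1F → c ≢ 1F → a ≢ b → a ≢ c → b ≢ c → Joined graph a b c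
    without-1 {a} {b} {c} a≢1 b≢1 c≢1 a≢b a≢c b≢c with a ≟ 2F | b ≟ 2F | c ≟ 2F
    ... | yes refl | _ | _ = joined-2 b c b≢1 c≢1 (≢-sym a≢b) (≢-sym a≢c) b≢c
    ... | no _ | yes refl | _ = joined-swap₁₂ graph (joined-2 a c a≢1 c≢1 a≢b (≢-sym b≢c) a≢c)
    ... | no _ | no _ | yes refl = joined-swap₂₃ graph (joined-swap₁₂ graph (joined-2 a b a≢1 b≢1 a≢c b≢c a≢b))
    ... | no a≢2 | no b≢2 | no c≢2 = star graph (near-0 a≢1 a≢2) (near-0 b≢1 b≢2) (near-0 c≢1 c≢2)

    joined : ∀ {a b c} → a ≢ b → a ≢ c → b ≢ c → Joined graph a b c
    joined {a} {b} {c} a≢b a≢c b≢c with a ≟ 1F | b ≟ 1F | c ≟ 1F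
    ... | yes refl | _ | _ = with-1 (≢-sym a≢b) (≢-sym a≢c) b≢c
    ... | no _ | yes refl | _ = joined-swap₁₂ graph (with-1 a≢b (≢-sym b≢c) a≢c)
    ... | no _ | no _ | yes refl = joined-swap₂₃ graph (joined-swap₁₂ graph (with-1 a≢c b≢c a≢b))
    ... | no a≢1 | no b≢1 | no c≢1 = without-1 a≢1 b≢1 c≢1 a≢b a≢c b≢c

    member : ℋ₃ (5 + m) (2 + m) 3 graph
    member = ℋ₃⁺ (s≤s (s≤s (s≤s z≤n))) (maxDegree 0F full bound) (joined⇒triplesSpan graph joined)
      where
      full : degreeOf 0F ≡ 2 + m
      full = cong suc (*-identityʳ (suc m))
      bound : ∀ k → degreeOf k ≤ 2 + m
      bound 0F = ≤-reflexive full
      bound 1F = ≤-reflexive full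
      bound 2F rewrite *-zeroʳ m = s≤s (s≤s z≤n)
      bound 3F rewrite *-zeroʳ m = s≤s (s≤s z≤n)
      bound 4F rewrite *-zeroʳ m = s≤s (s≤s z≤n)

    size≤2n∸5 : size graph ≤ 2 * (5 + m) ∸ 5
    size≤2n∸5 = ≤-trans size≤ (≤-reflexive (trans weight (sym (trans (cong (_∸ 5) (double m)) (m+n∸m≡n 5 _)))))
      where
      double : ∀ m → 2 * (5 + m) ≡ 5 + (3 + suc m * 2)
      double = solve-∀
      weight : weigh 4 (suc m) (λ k → weigh 4 (suc m) (λ l → 𝟙 (R k l))) ≡ 3 + suc m * 2
      weight rewrite *-zeroʳ m = refl

module CompleteBipartite where

  R : Bool → Bool → Bool
  R k l = k ∧ not l

  irrefl : ∀ k → R k k ≡ false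
  irrefl true  = refl
  irrefl false = refl

  #-initial : ∀ {n ℓ} → ℓ ≤ n → # {n} (λ u → toℕ u <ᵇ ℓ) ≡ ℓ
  #-initial {n} {zero}  _        = sum-replicate-zero n
  #-initial {suc n} {suc ℓ} (s≤s l) = cong suc (#-initial l)

  module _ {n ℓ : ℕ} (0<ℓ : 0 < ℓ) (ℓ<n : ℓ < n) where

    side : Fin n → Bool
    side u = toℕ u <ᵇ ℓ

    graph : Graph n
    graph = blowUp R irrefl side

    #-true : # side ≡ ℓ
    #-true = #-initial (<⇒≤ ℓ<n)

    #-false : # (not ∘ side) ≡ n ∸ ℓ
    #-false = trans (sym (m+n∸m≡n ℓ _))
        (cong (_∸ ℓ) (trans (cong (_+ # (not ∘ side)) (sym #-true)) (#-complement side)))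

    ∃-true : ∃[ u ] side u ≡ true
    ∃-true = let u , e , _ = #⇒∃-outside side [] (≤-trans 0<ℓ (≤-reflexive (sym #-true))) in u , e

    ∃-false : ∃[ u ] side u ≡ false
    ∃-false = let u , e , _ = #⇒∃-outside (not ∘ side) [] (≤-trans (m<n⇒0<n∸m ℓ<n) (≤-reflexive (sym #-false))) in
      u , not-injective e

    degree-true : ∀ u → side u ≡ true → degree graph u ≡ n ∸ ℓ
    degree-true u e = trans (degree≡# graph u) (trans (sum-cong-≗ same) #-false)
      where
      same : ∀ v → 𝟙 (R (side u) (side v) ∨ R (side v) (side u)) ≡ 𝟙 (not (side v))
      same v rewrite e with side v
      ... | true  = refl
      ... | false = refl

    degree-false : ∀ u → side u ≡ false → degree graph u ≡ ℓ
    degree-false u e = trans (degree≡# graph u) (trans (sum-cong-≗ same) #-true)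
      where
      same : ∀ v → 𝟙 (R (side u) (side v) ∨ R (side v) (side u)) ≡ 𝟙 (side v)
      same v rewrite e with side v
      ... | true  = refl
      ... | false = refl

    across : ∀ {u v} → side u ≡ true → side v ≡ false → Near graph u v
    across e f = inj₂ (cong₂ (λ k l → R k l ∨ R l k) e f)

    across′ : ∀ {u v} → side u ≡ false → side v ≡ true → Near graph u v
    across′ e f = inj₂ (cong₂ (λ k l → R k l ∨ R l k) e f)

    -- Vertices on one side have a common neighbour on the other; in a mixed triple the vertex alone
    -- on its side is the centre.
    joined : ∀ a b c → Joined graph a b c
    joined a b c = by-sides (side a) (side b) (side c) refl refl refl
      where
      by-sides : ∀ i j k → side a ≡ i → side b ≡ j → side c ≡ k → Joined graph a b c
      by-sides true  true  true  p q r = star graph (across′ (proj₂ ∃-false) p)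
          (across′ (proj₂ ∃-false) q) (across′ (proj₂ ∃-false) r)
      by-sides false false false p q r = star graph (across (proj₂ ∃-true) p)
          (across (proj₂ ∃-true) q) (across (proj₂ ∃-true) r)
      by-sides true  true  false p q r = star graph {r = c} (across′ r p) (across′ r q) (inj₁ refl)
      by-sides true  false true  p q r = star graph {r = b} (across′ q p) (inj₁ refl) (across′ q r)
      by-sides false true  true  p q r = star graph {r = a} (inj₁ refl) (across′ p q) (across′ p r)
      by-sides false false true  p q r = star graph {r = c} (across r p) (across r q) (inj₁ refl)
      by-sides false true  false p q r = star graph {r = b} (across q p) (inj₁ refl) (across q r)
      by-sides true  false false p q r = star graph {r = a} (inj₁ refl) (across p q) (across p r)

    member : 3 ≤ n → n ∸ ℓ ≤ ℓ → ℋ₃ n ℓ 3 graph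
    member 3≤n n∸ℓ≤ℓ = ℋ₃⁺ 3≤n ((proj₁ ∃-false , degree-false _ (proj₂ ∃-false)) , λ v → bound v (side v) refl)
      (joined⇒triplesSpan graph λ {a} {b} {c} _ _ _ → joined a b c)
      where
      bound : ∀ v b → side v ≡ b → degree graph v ≤ ℓ
      bound v true  e = ≤-trans (≤-reflexive (degree-true v e)) n∸ℓ≤ℓ
      bound v false e = ≤-reflexive (degree-false v e)

    size≤ℓ[n∸ℓ] : size graph ≤ ℓ * (n ∸ ℓ)
    size≤ℓ[n∸ℓ] = begin
      size graph                                 ≤⟨ size-blowUp R irrefl side ⟩
      ## (λ u v → R (side u) (side v))           ≡⟨ sum-cong-≗ row ⟩
      sum (λ u → 𝟙 (side u) * (n ∸ ℓ))           ≡⟨ *-distribʳ-sum (n ∸ ℓ) (𝟙 ∘ side) ⟨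
      # side * (n ∸ ℓ)                           ≡⟨ cong (_* (n ∸ ℓ)) #-true ⟩
      ℓ * (n ∸ ℓ)                                ∎
      where
      open ≤-Reasoning
      row : ∀ u → # (λ v → R (side u) (side v)) ≡ 𝟙 (side u) * (n ∸ ℓ)
      row u with side u
      ... | true  = trans #-false (sym (+-identityʳ _))
      ... | false = sum-replicate-zero n

-- Existence of the minimum

grows-map : ∀ {G H : Graph n} {S} → (∀ {u v} → Adj G u v → Adj H u v) →
            ∀ {k X} → Grows G S k X → Grows H S k X
grows-map G⊆H {zero}  g = g
grows-map G⊆H {suc k} (inj₁ g) = inj₁ (grows-map G⊆H {k} g)
grows-map G⊆H {suc k} (inj₂ (p , q , p∈X , pq , g)) = inj₂ (p , q , p∈X , G⊆H pq , grows-map G⊆H {k} g)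

module _ (G H : Graph n) (G≗H : ∀ u v → adj G u v ≡ adj H u v) where

  degree-cong : ∀ v → degree G v ≡ degree H v
  degree-cong v = cong ∣_∣ (tabulate-cong (G≗H v))

  size-cong : size G ≡ size H
  size-cong = sum-cong-≗ λ u → cong ∣_∣ (tabulate-cong λ v → cong ((u <ᶠ v) ∧_) (G≗H u v))

  maxDegree-cong : ∀ {ℓ} → MaxDegree G ℓ → MaxDegree H ℓ
  maxDegree-cong ((v , e) , max) =
    (v , trans (sym (degree-cong v)) e) , λ u → ≤-trans (≤-reflexive (sym (degree-cong u))) (max u)

  triplesSpan-cong : ∀ {d} → TriplesSpan G d → TriplesSpan H d
  triplesSpan-cong {d} spans S e = let r , g = spans S e in
    r , grows-map {G = G} {H} (λ {u} {v} uv → trans (sym (G≗H u v)) uv) {d} g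

-- Dropping loops and symmetrising turns every set of ordered pairs into a graph, so a search over
-- graphs becomes a search over subsets without a validity condition.
fromSubset : ∀ n → Subset (n * n) → Graph n
fromSubset n X = record
  { adj    = λ u v → not (u == v) ∧ (arcs u v ∨ arcs v u)
  ; sym    = λ u v → cong₂ (λ b c → not b ∧ c) (==-comm u v) (∨-comm (arcs u v) (arcs v u))
  ; irrefl = λ v → cong (λ b → not b ∧ (arcs v v ∨ arcs v v)) (==-refl v)
  }
  where
  arcs : Fin n → Fin n → Bool
  arcs u v = lookup X (combine u v)
  ==-comm : ∀ (u v : Fin n) → (u == v) ≡ (v == u)
  ==-comm u v with u ≟ v
  ... | yes refl = sym (==-refl u)
  ... | no u≢v = sym (≢⇒== (≢-sym u≢v))

toSubset : Graph n → Subset (n * n)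
toSubset {n} G = tabulate (uncurry (adj G) ∘ remQuot n)

lookup-toSubset : ∀ (G : Graph n) u v → lookup (toSubset G) (combine u v) ≡ adj G u v
lookup-toSubset G u v = trans (lookup∘tabulate _ (combine u v)) (cong (uncurry (adj G)) (remQuot-combine u v))

-- Agreement is only pointwise, not an equality of records; this is why degree, size and spanning
-- are transported by congruence lemmas.
from∘toSubset : ∀ (G : Graph n) u v → adj G u v ≡ adj (fromSubset _ (toSubset G)) u v
from∘toSubset G u v = by-equality (u ≟ v)
  where
  by-equality : Dec (u ≡ v) → adj G u v ≡ adj (fromSubset _ (toSubset G)) u v
  by-equality (yes refl) = trans (Graph.irrefl G u) (sym (Graph.irrefl (fromSubset _ (toSubset G)) u))
  by-equality (no u≢v) rewrite ≢⇒== u≢v | lookup-toSubset G u v | lookup-toSubset G v u | Graph.sym G v u =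
    sym (∨-idem (adj G u v))

maxDegree? : ∀ (G : Graph n) ℓ → Dec (MaxDegree G ℓ)
maxDegree? G ℓ = any? (λ v → degree G v ≟ℕ ℓ) ×-dec all? (λ v → degree G v ≤? ℓ)

member? : ∀ {ℓ d} → 3 ≤ n → ∀ k → Dec (Σ[ G ∈ Graph n ] ℋ₃ n ℓ d G × size G ≡ k)
member? {n} {ℓ} {d} 3≤n k = map′ found encode
  (anySubset? λ X → maxDegree? (fromSubset n X) ℓ ×-dec
      (triplesSpan-dec (fromSubset n X) d ×-dec (size (fromSubset n X) ≟ℕ k)))
  where
  found : ∃[ X ] MaxDegree (fromSubset n X) ℓ × TriplesSpan (fromSubset n X) d × size (fromSubset n X) ≡ k →
          Σ[ G ∈ Graph n ] ℋ₃ n ℓ d G × size G ≡ k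
  found (X , max , spans , e) = fromSubset n X , ℋ₃⁺ 3≤n max spans , e
  encode : Σ[ G ∈ Graph n ] ℋ₃ n ℓ d G × size G ≡ k →
           ∃[ X ] MaxDegree (fromSubset n X) ℓ × TriplesSpan (fromSubset n X) d × size (fromSubset n X) ≡ k
  encode (G , h , e) = let max , spans = ℋ₃⁻ h ; H = fromSubset n (toSubset G) ; G≗H = from∘toSubset G in
    toSubset G , maxDegree-cong G H G≗H max , triplesSpan-cong G H G≗H spans , trans (sym (size-cong G H G≗H)) e

degree≤size : ∀ (G : Graph n) v → degree G v ≤ size G
degree≤size G v = begin
  degree G v                          ≡⟨ degree≡# G v ⟩
  # (adj G v)                         ≤⟨ sum-mono (λ x → below-v (adj G v x) refl) ⟩
  sum (down G ((v ==_) ∷ []))         ≤⟨ sum-down≤size G ((v ==_) ∷ []) ⟩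
  size G                              ∎
  where
  open ≤-Reasoning
  below-v : ∀ {x} b → adj G v x ≡ b → 𝟙 b ≤ down G ((v ==_) ∷ []) x
  below-v false _  = z≤n
  below-v true  vx = one≤down G ((v ==_) ∷ []) (adj-sym G vx) (here (==-refl v) (≢⇒== (Adj⇒≢ G vx)))

-- Values of e₃ and the bounds in (5)

e₃-n∸1 : ∀ m → e₃[ 4 + m , 3 + m , 3 ]≔ [ 3 + m ]
e₃-n∸1 m = IsMin-e₃ (StarGraph.graph (3 + m)) (StarGraph.member (3 + m) (s≤s (s≤s z≤n)))
    (StarGraph.size≤m (3 + m)) lower
  where
  lower : ∀ H → ℋ₃ (4 + m) (3 + m) 3 H → 3 + m ≤ size H
  lower H h = let ((v , e) , _) , _ = ℋ₃⁻ h in ≤-trans (≤-reflexive (sym e)) (degree≤size H v)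

e₃-n∸2 : ∀ m → e₃[ 4 + m , 2 + m , 3 ]≔ [ 2 * (4 + m) ∸ 5 ]
e₃-n∸2 m = IsMin-e₃ (OneFar.graph m) (OneFar.member m) (OneFar.size≤2n∸5 m) lower
  where
  open ≤-Reasoning
  double : ∀ m → 2 * (4 + m) ≡ 4 + ((2 + m) + (2 + m))
  double = solve-∀
  lower : ∀ H → ℋ₃ (4 + m) (2 + m) 3 H → 2 * (4 + m) ∸ 5 ≤ size H
  lower H h = let ((v , e) , _) , spans = ℋ₃⁻ h in m≤n+o⇒m∸n≤o _ 5 (begin
    2 * (4 + m)                         ≡⟨ double m ⟩
    4 + ((2 + m) + (2 + m))             ≡⟨ cong (λ d → 4 + (d + d)) e ⟨
    4 + (degree H v + degree H v)
      ≤⟨ +-monoʳ-≤ 4 (2degree≤1+size H spans (trans (cong (_+ 2) e) (+-comm (2 + m) 2))) ⟩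
    4 + (size H + 1)                    ≡⟨ cong (4 +_) (+-comm (size H) 1) ⟩
    5 + size H                          ∎)

e₃-n∸3 : ∀ m → e₃[ 5 + m , 2 + m , 3 ]≔ [ 2 * (5 + m) ∸ 5 ]
e₃-n∸3 m = IsMin-e₃ (TwoFar.graph m) (TwoFar.member m) (TwoFar.size≤2n∸5 m) lower
  where
  open ≤-Reasoning
  double : ∀ m → 2 * (5 + m) ≡ 5 + ((2 + m) + (2 + m) + 1)
  double = solve-∀
  lower : ∀ H → ℋ₃ (5 + m) (2 + m) 3 H → 2 * (5 + m) ∸ 5 ≤ size H
  lower H h = let ((v , e) , max) , spans = ℋ₃⁻ h in m≤n+o⇒m∸n≤o _ 5 (begin
    2 * (5 + m)                         ≡⟨ double m ⟩
    5 + ((2 + m) + (2 + m) + 1)         ≡⟨ cong (λ d → 5 + (d + d + 1)) e ⟨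
    5 + (degree H v + degree H v + 1)
      ≤⟨ +-monoʳ-≤ 5 (2degree+1≤size H spans (trans (cong (_+ 3) e) (+-comm (2 + m) 3))
                                             (λ u → ≤-trans (max u) (≤-reflexive (sym e)))) ⟩
    5 + size H                          ∎)

e₃-2-∞ : 6 ≤ n → e₃[ n , 2 , 3 ]≔ ⊤⁺
e₃-2-∞ 6≤n j (G , h , _) = let ((v , e) , max) , spans = ℋ₃⁻ h in
  ¬maxDegree-2 G spans (≤-trans (≤-reflexive (cong (_+ 4) e)) 6≤n) max

-- The complete bipartite graph makes the search for the minimum finite and bounds its outcome; n ≤
-- 2ℓ ensures that its other degree, n - ℓ, does not exceed ℓ.
e₃-bounds : ∀ {ℓ} → 3 ≤ ℓ → ℓ + 4 ≤ n → n ≤ 2 * ℓ →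
            ∃[ e ] (e₃[ n , ℓ , 3 ]≔ e) × [ n ] ≤⁺ e × e ≤⁺ [ ℓ * (n ∸ ℓ) ]
e₃-bounds {n} {ℓ} 3≤ℓ ℓ+4≤n n≤2ℓ = bounds (least (member? 3≤n) (size K) (K , inℋ , refl))
  where
  ℓ<n = ≤-trans (≤-reflexive (+-comm 1 ℓ)) (≤-trans (+-monoʳ-≤ ℓ (s≤s z≤n)) ℓ+4≤n)
  0<ℓ = ≤-trans (s≤s z≤n) 3≤ℓ
  3≤n = ≤-trans 3≤ℓ (<⇒≤ ℓ<n)
  K = CompleteBipartite.graph 0<ℓ ℓ<n
  inℋ = CompleteBipartite.member 0<ℓ ℓ<n 3≤n
    (m≤n+o⇒m∸n≤o n ℓ (≤-trans n≤2ℓ (≤-reflexive (cong (ℓ +_) (+-identityʳ ℓ)))))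
  bounds : ∃[ m ] e₃[ n , ℓ , 3 ]≔ [ m ] → ∃[ e ] (e₃[ n , ℓ , 3 ]≔ e) × [ n ] ≤⁺ e × e ≤⁺ [ ℓ * (n ∸ ℓ) ]
  bounds (m , min@((G , h , refl) , low)) =
    let ((v , e) , _) , spans = ℋ₃⁻ h in
    [ m ] , min
    , [ n≤size G spans (≤-trans (≤-reflexive (cong (_+ 4) e)) ℓ+4≤n) (≤-trans 3≤ℓ (≤-reflexive (sym e))) ]
    , [ ≤-trans (low (size K) (K , inℋ , refl)) (CompleteBipartite.size≤ℓ[n∸ℓ] 0<ℓ ℓ<n) ]

theorem3p2 : ∀ (n ℓ : ℕ) → 4 ≤ n → 2 ≤ ℓ → ℓ ≤ n ∸ 1 →
    (ℓ ≡ n ∸ 1 → e₃[ n , ℓ , 3 ]≔ [ n ∸ 1 ])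
    × (ℓ ≡ n ∸ 2 → e₃[ n , ℓ , 3 ]≔ [ 2 * n ∸ 5 ])
    × (ℓ ≡ n ∸ 3 → e₃[ n , ℓ , 3 ]≔ [ 2 * n ∸ 5 ])
    × (ℓ ≡ 2 →
    (n ≡ 4 → e₃[ n , ℓ , 3 ]≔ [ 3 ])
    × (n ≡ 5 → e₃[ n , ℓ , 3 ]≔ [ 5 ])
    × (6 ≤ n → e₃[ n , ℓ , 3 ]≔ ⊤⁺))
    × (n ≤ 2 * ℓ → ℓ ≤ n ∸ 4 →
    ∃[ e ] (e₃[ n , ℓ , 3 ]≔ e) × [ n ] ≤⁺ e × e ≤⁺ [ ℓ * (n ∸ ℓ) ])
theorem3p2 n@(suc (suc (suc (suc m)))) ℓ (s≤s (s≤s (s≤s (s≤s z≤n)))) 2≤ℓ _ =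
  (λ { refl → e₃-n∸1 m })
  , (λ { refl → e₃-n∸2 m })
  , (λ { refl → part₃ m 2≤ℓ })
  -- With ℓ = 2, n = 4 is the case ℓ = n - 2, attained by a path, and n = 5 the case ℓ = n - 3,
  -- attained by a 5-cycle.
  , (λ { refl → (λ { refl → e₃-n∸2 0 }) , (λ { refl → e₃-n∸3 0 }) , e₃-2-∞ })
  , λ n≤2ℓ ℓ≤m → e₃-bounds (4≤n≤2ℓ⇒3≤ℓ ℓ≤m n≤2ℓ) (≤-trans (+-monoˡ-≤ 4 ℓ≤m) (≤-reflexive (+-comm m 4))) n≤2ℓ
  where
  part₃ : ∀ m → 2 ≤ 1 + m → e₃[ 4 + m , 1 + m , 3 ]≔ [ 2 * (4 + m) ∸ 5 ]
  part₃ (suc m) _ = e₃-n∸3 m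
  -- For n = 4 this would mean ℓ = 1.
  part₃ zero (s≤s ())
  4≤n≤2ℓ⇒3≤ℓ : ℓ ≤ m → 4 + m ≤ 2 * ℓ → 3 ≤ ℓ
  4≤n≤2ℓ⇒3≤ℓ ℓ≤m n≤2ℓ = ≤-trans (n≤1+n 3) (+-cancelʳ-≤ ℓ 4 ℓ
    (≤-trans (+-monoʳ-≤ 4 ℓ≤m) (≤-trans n≤2ℓ (≤-reflexive (cong (ℓ +_) (+-identityʳ ℓ))))))
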